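{- For $\beta\in\mathbb{N}$, $l,n\in\mathbb{N}$, $r\in\mathbb{Z}$ let $$T_{l,\beta}^{(2)}(n,r)=\frac{l!\,2^l}{\lfloor n/2^{\beta-1}\rfloor!}\sum_{k\equiv r\ (\mathrm{mod}\ 2^{\beta})}\binom nk(-1)^k\binom{(k-r)/2^{\beta}}l.$$ Let $\alpha,c,d,e\in\mathbb{N}$ with $d<2^e$. Then $$T_{l,\alpha+1}^{(2)}\big(2^{\alpha}(2^e+d),\,2^{\alpha}c\big)\equiv\delta_{l,d}\pmod 2\quad\text{for all } l=0,\ldots,d,$$ where $\delta_{l,d}$ is the Kronecker delta.
   Context: The sum runs over all integers $k\equiv r\pmod{2^\beta}$ with $\binom nk=0$ unless $0\le k\le n$; $\binom xl=x(x-1)\cdots(x-l+1)/l!$. For rationals $u,v$, $u\equiv v\pmod 2$ means $\operatorname{ord}_2(u-v)\ge1$. -}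

module Defs where

open import Data.Bool.Base using (if_then_else_)
open import Data.Integer.Base as ℤ using (ℤ; +_; 0ℤ; 1ℤ; -1ℤ)
open import Data.Integer.Divisibility.Signed as ℤ using (_∣?_)
open import Data.List.Base using (List; map; foldr; filter; upTo)
open import Data.List.Extrema.Nat using (max)
open import Data.Nat.Base as ℕ using (ℕ; zero; suc; _!; _^_)
open import Data.Nat.Combinatorics using (_C_)
import Data.Nat.Divisibility as ℕ
import Data.Nat.DivMod as ℕ
import Data.Nat.Properties as ℕ
open import Data.Rational.Base using (ℚ; 0ℚ; 1ℚ; _+_; _*_; _-_; _/_; ↥_; ↧ₙ_)
open import Data.Rational.Properties using (_≟_)
open import Relation.Binary.Construct.Add.Supremum.NonStrict ℤ._≤_ using (_≤⁺_)
open import Relation.Nullary.Construct.Add.Supremum using (_⁺; ⊤⁺; [_])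
open import Relation.Nullary.Decidable.Core using (does)

-- The largest a with 2 ^ a ∣ m, for m > 0; every such a satisfies a < 2 ^ a ≤ m.
ord₂ℕ : ℕ → ℕ
ord₂ℕ m = max 0 (filter (λ a → 2 ^ a ℕ.∣? m) (upTo m))

-- ord₂ 0 = ∞, written ⊤⁺.
ord₂ : ℚ → ℤ ⁺
ord₂ u = if does (u ≟ 0ℚ)
  then ⊤⁺
  else [ + ord₂ℕ ℤ.∣ ↥ u ∣ ℤ.- + ord₂ℕ (↧ₙ u) ]

infix 4 _≡_[mod2]

_≡_[mod2] : ℚ → ℚ → Set
u ≡ v [mod2] = [ 1ℤ ] ≤⁺ ord₂ (u - v)

falling : ℚ → ℕ → ℚ
falling x zero    = 1ℚ
falling x (suc l) = falling x l * (x - + l / 1)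

binom : ℚ → ℕ → ℚ
binom x l = falling x l * (1ℤ / (l !)) {{l ℕ.!≢0}}

sumℚ : List ℚ → ℚ
sumℚ = foldr _+_ 0ℚ

-- The sum is restricted to 0 ≤ k ≤ n, as the binomial coefficient n C k
-- vanishes for all other integers k.  ⌊ n / 2^(β-1) ⌋ is computed as
-- ⌊ 2n / 2^β ⌋, so that β = 0 is covered too.
T : (l β n : ℕ) → ℤ → ℚ
T l β n r =
  (+ (l ! ℕ.* 2 ^ l) / (((2 ℕ.* n) ℕ./ 2 ^ β) !)) * sumℚ (map term ks)
  where
  instance
    2^β≢0 : ℕ.NonZero (2 ^ β)
    2^β≢0 = ℕ.m^n≢0 2 β

    floor!≢0 : ℕ.NonZero (((2 ℕ.* n) ℕ./ 2 ^ β) !)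
    floor!≢0 = ((2 ℕ.* n) ℕ./ 2 ^ β) ℕ.!≢0

  ks : List ℕ
  ks = filter (λ k → + (2 ^ β) ∣? (+ k ℤ.- r)) (upTo (suc n))

  term : ℕ → ℚ
  term k = ((+ (n C k) ℤ.* -1ℤ ℤ.^ k) / 1) * binom ((+ k ℤ.- r) / 2 ^ β) l

δ : ℕ → ℕ → ℚ
δ l d = if does (l ℕ.≟ d) then 1ℚ else 0ℚ

{-# OPTIONS --safe #-}
module Submission where

-- Put h = 2^α, m = 2^e + d, n = h m, f(t) = ∏_{i<l} (t − 2i), and let g(x) be f(x / h) if 2h ∣ x
-- and 0 otherwise.  Then T = W / m!, where W is the value at −hc of the n-fold
-- difference (1 − E)^n g, E being the shift by 1.  Divisibility below is in ℤ₍₂₎.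
--
-- Since (1 − E)^h = (1 − E^h) + 2G with G a polynomial in E, and 2 j! ∣ 2^j for j ≥ 1, the
-- binomial theorem gives (1 − E)^{hm} g ≡ (1 − E^h)^m g modulo 2 m!, as soon as
-- i! ∣ (1 − E^h)^i g for all i.  On multiples of h the operator 1 − E^h acts on g as 1 − E acts
-- on q, the restriction of f to even arguments.
--
-- Finally 2q = f + σ f with σ(t) = (−1)^t, whence, with Δ = E − 1,
--   2 (1 − E)^m q = (−Δ)^m f + σ Σ_i (m C i) 2^i Δ^{m−i} f,
-- where j! ∣ Δ^j f, Δ^l f = l! and Δ^j f = 0 for j > l.  This yields m! ∣ (1 − E)^m q for
-- every m.  For m = 2^e + d and l ≤ d only the term i = 2^e survives modulo 4 m!, because
-- 4 i! ∣ 2^i for 2^e < i < 2^{e+1}; that term is nonzero only for l = d, and 2 (2^e)! is an odd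
-- multiple of 2^(2^e).

open import Algebra.Bundles using (CommutativeMonoid; CommutativeRing)
import Algebra.Properties.CommutativeSemigroup as CommutativeSemigroupProperties
open import Data.Bool.Base using (if_then_else_)
open import Data.Fin.Base using (Fin; zero; suc; toℕ; fromℕ<; punchIn)
import Data.Fin.Properties as Fin
open import Data.Integer.Base as ℤ using (ℤ; +_; -[1+_]; 0ℤ; 1ℤ; -1ℤ; _+_; _*_; _-_; -_)
open import Data.Integer.Divisibility.Signed using (_∣_; divides; _∣?_; ∣-refl; ∣m∣n⇒∣m+n; ∣n⇒∣m*n; *-monoʳ-∣; ∣m+n∣m⇒∣n; ∣⇒∣ᵤ; ∣ᵤ⇒∣)
import Data.Integer.Properties as ℤ
open import Data.Integer.Tactic.RingSolver using (solve-∀)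
open import Data.List.Base using (map; filter; upTo; applyUpTo)
open import Data.List.Extrema.Nat using (max≤v⁺; v≤max⁺)
open import Data.List.Membership.Propositional using (lose)
open import Data.List.Membership.Propositional.Properties using (∈-filter⁺; ∈-upTo⁺)
import Data.List.Relation.Unary.All as All
open import Data.List.Relation.Unary.All.Properties using (all-filter)
open import Data.Nat.Base as ℕ using (ℕ; zero; suc; _!; z≤n; s≤s; s≤s⁻¹; z<s)
open import Data.Nat.Combinatorics using (_C_; nCk≡n!/k![n-k]!; k![n∸k]!∣n!)
open import Data.Nat.Coprimality using (recompute)
import Data.Nat.Divisibility as ℕ
import Data.Nat.DivMod as ℕ
open import Data.Nat.Induction using (<-rec)
import Data.Nat.Properties as ℕ
import Data.Nat.Tactic.RingSolver as ℕ-Solver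
open import Data.Product.Base using (_×_; _,_; ∃; proj₁; proj₂)
open import Data.Rational.Base as ℚ using (ℚ; mkℚ; _/_; toℚᵘ; 0ℚ; 1ℚ)
import Data.Rational.Properties as ℚ
open import Data.Rational.Unnormalised.Base as ℚᵘ using (mkℚᵘ; *≡*; _≃_)
import Data.Rational.Unnormalised.Properties as ℚᵘ
open import Data.Sum.Base using (_⊎_; inj₁; inj₂)
open import Data.Vec.Functional using (removeAt)
open import Defs
open import Relation.Binary.Construct.Add.Supremum.NonStrict ℤ._≤_ using (_≤⁺_; [_]; _≤⊤⁺)
open import Relation.Binary.Definitions using (tri<; tri≈; tri>)
open import Relation.Binary.PropositionalEquality
open import Relation.Nullary using (contradiction; ¬_; yes; no)
open import Relation.Nullary.Construct.Add.Supremum using ([_])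
open import Relation.Nullary.Decidable using (dec-true; dec-false)
open import Relation.Unary using (Decidable)

import Algebra.Properties.Semiring.Sum ℤ.+-*-semiring as Σℤ
module ℚ* = CommutativeSemigroupProperties (CommutativeMonoid.commutativeSemigroup ℚ.*-1-commutativeMonoid)

open ≡-Reasoning

-- The ring of shift operators

infixl 6 _⊕_
infixl 7 _⊛_

-- Integer polynomials in `E`, kept as syntax: linearity and commutation then follow by induction on
-- the expression, and the binomial theorem and the solver become available through `Op-ring`.
data Op : Set where
  E 𝟘 𝟙   : Op
  neg     : Op → Op
  _⊕_ _⊛_ : Op → Op → Op

⟦_⟧ : Op → (ℤ → ℤ) → ℤ → ℤ
⟦ E ⟧     g x = g (1ℤ + x)
⟦ 𝟘 ⟧     g x = 0ℤ
⟦ 𝟙 ⟧     g x = g x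
⟦ neg a ⟧ g x = - ⟦ a ⟧ g x
⟦ a ⊕ b ⟧ g x = ⟦ a ⟧ g x + ⟦ b ⟧ g x
⟦ a ⊛ b ⟧ g x = ⟦ a ⟧ (⟦ b ⟧ g) x

infix 4 _≈_
_≈_ : Op → Op → Set
a ≈ b = ∀ g → ⟦ a ⟧ g ≗ ⟦ b ⟧ g

⟦⟧-cong : ∀ a {f g} → f ≗ g → ⟦ a ⟧ f ≗ ⟦ a ⟧ g
⟦⟧-cong E       f≗g x = f≗g (1ℤ + x)
⟦⟧-cong 𝟘       f≗g x = refl
⟦⟧-cong 𝟙       f≗g x = f≗g x
⟦⟧-cong (neg a) f≗g x = cong -_ (⟦⟧-cong a f≗g x)
⟦⟧-cong (a ⊕ b) f≗g x = cong₂ _+_ (⟦⟧-cong a f≗g x) (⟦⟧-cong b f≗g x)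
⟦⟧-cong (a ⊛ b) f≗g x = ⟦⟧-cong a (⟦⟧-cong b f≗g) x

⟦⟧-0 : ∀ a x → ⟦ a ⟧ (λ _ → 0ℤ) x ≡ 0ℤ
⟦⟧-0 E       x = refl
⟦⟧-0 𝟘       x = refl
⟦⟧-0 𝟙       x = refl
⟦⟧-0 (neg a) x = cong -_ (⟦⟧-0 a x)
⟦⟧-0 (a ⊕ b) x = cong₂ _+_ (⟦⟧-0 a x) (⟦⟧-0 b x)
⟦⟧-0 (a ⊛ b) x = trans (⟦⟧-cong a (⟦⟧-0 b) x) (⟦⟧-0 a x)

+-interchange : ∀ a b c d → (a + b) + (c + d) ≡ (a + c) + (b + d)
+-interchange = solve-∀

⟦⟧-+ : ∀ a f g x → ⟦ a ⟧ (λ y → f y + g y) x ≡ ⟦ a ⟧ f x + ⟦ a ⟧ g x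
⟦⟧-+ E       f g x = refl
⟦⟧-+ 𝟘       f g x = refl
⟦⟧-+ 𝟙       f g x = refl
⟦⟧-+ (neg a) f g x = trans (cong -_ (⟦⟧-+ a f g x)) (ℤ.neg-distrib-+ (⟦ a ⟧ f x) _)
⟦⟧-+ (a ⊕ b) f g x = trans (cong₂ _+_ (⟦⟧-+ a f g x) (⟦⟧-+ b f g x)) (+-interchange (⟦ a ⟧ f x) _ _ _)
⟦⟧-+ (a ⊛ b) f g x = trans (⟦⟧-cong a (⟦⟧-+ b f g) x) (⟦⟧-+ a (⟦ b ⟧ f) (⟦ b ⟧ g) x)

⟦⟧-* : ∀ a c f x → ⟦ a ⟧ (λ y → c * f y) x ≡ c * ⟦ a ⟧ f x
⟦⟧-* E       c f x = refl
⟦⟧-* 𝟘       c f x = sym (ℤ.*-zeroʳ c)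
⟦⟧-* 𝟙       c f x = refl
⟦⟧-* (neg a) c f x = trans (cong -_ (⟦⟧-* a c f x)) (ℤ.neg-distribʳ-* c (⟦ a ⟧ f x))
⟦⟧-* (a ⊕ b) c f x = trans (cong₂ _+_ (⟦⟧-* a c f x) (⟦⟧-* b c f x)) (sym (ℤ.*-distribˡ-+ c (⟦ a ⟧ f x) _))
⟦⟧-* (a ⊛ b) c f x = trans (⟦⟧-cong a (⟦⟧-* b c f) x) (⟦⟧-* a c (⟦ b ⟧ f) x)

⟦⟧-neg : ∀ a f x → ⟦ a ⟧ (λ y → - f y) x ≡ - ⟦ a ⟧ f x
⟦⟧-neg a f x = begin
  ⟦ a ⟧ (λ y → - f y) x      ≡⟨ ⟦⟧-cong a (λ y → sym (ℤ.-1*i≡-i (f y))) x ⟩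
  ⟦ a ⟧ (λ y → -1ℤ * f y) x  ≡⟨ ⟦⟧-* a -1ℤ f x ⟩
  -1ℤ * ⟦ a ⟧ f x            ≡⟨ ℤ.-1*i≡-i _ ⟩
  - ⟦ a ⟧ f x                ∎

E-comm : ∀ a → E ⊛ a ≈ a ⊛ E
E-comm E       g x = refl
E-comm 𝟘       g x = refl
E-comm 𝟙       g x = refl
E-comm (neg a) g x = cong -_ (E-comm a g x)
E-comm (a ⊕ b) g x = cong₂ _+_ (E-comm a g x) (E-comm b g x)
E-comm (a ⊛ b) g x = trans (E-comm a (⟦ b ⟧ g) x) (⟦⟧-cong a (E-comm b g) x)

-- Every operator is built from `E`, so `E-comm` and the linearity of `⟦ b ⟧` suffice.
⊛-comm : ∀ a b → a ⊛ b ≈ b ⊛ a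
⊛-comm E       b g x = E-comm b g x
⊛-comm 𝟘       b g x = sym (⟦⟧-0 b x)
⊛-comm 𝟙       b g x = refl
⊛-comm (neg a) b g x = trans (cong -_ (⊛-comm a b g x)) (sym (⟦⟧-neg b (⟦ a ⟧ g) x))
⊛-comm (a ⊕ c) b g x = trans (cong₂ _+_ (⊛-comm a b g x) (⊛-comm c b g x)) (sym (⟦⟧-+ b (⟦ a ⟧ g) (⟦ c ⟧ g) x))
⊛-comm (a ⊛ c) b g x = trans (⟦⟧-cong a (⊛-comm c b g) x) (⊛-comm a b (⟦ c ⟧ g) x)

Op-ring : CommutativeRing _ _
Op-ring = record
  { Carrier = Op ; _≈_ = _≈_ ; _+_ = _⊕_ ; _*_ = _⊛_ ; -_ = neg ; 0# = 𝟘 ; 1# = 𝟙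
  ; isCommutativeRing = record
    { isRing = record
      { +-isAbelianGroup = record
        { isGroup = record
          { isMonoid = record
            { isSemigroup = record
              { isMagma = record
                { isEquivalence = record
                  { refl = λ g x → refl
                  ; sym = λ p g x → sym (p g x)
                  ; trans = λ p q g x → trans (p g x) (q g x) }
                ; ∙-cong = λ p q g x → cong₂ _+_ (p g x) (q g x) }
              ; assoc = λ a b c g x → ℤ.+-assoc (⟦ a ⟧ g x) _ _ }
            ; identity = (λ a g x → ℤ.+-identityˡ _) , (λ a g x → ℤ.+-identityʳ _) }
          ; inverse = (λ a g x → ℤ.+-inverseˡ (⟦ a ⟧ g x)) , (λ a g x → ℤ.+-inverseʳ (⟦ a ⟧ g x))
          ; ⁻¹-cong = λ p g x → cong -_ (p g x) }
        ; comm = λ a b g x → ℤ.+-comm (⟦ a ⟧ g x) _ }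
      ; *-cong = λ {a} {a′} {b} {b′} p q g x → trans (⟦⟧-cong a (q g) x) (p (⟦ b′ ⟧ g) x)
      ; *-assoc = λ a b c g x → refl
      ; *-identity = (λ a g x → refl) , (λ a g x → refl)
      ; distrib = (λ a b c g x → ⟦⟧-+ a (⟦ b ⟧ g) (⟦ c ⟧ g) x) , (λ a b c g x → refl) }
    ; *-comm = ⊛-comm } }

open CommutativeRing Op-ring using (semiring; commutativeSemiring)
open import Algebra.Properties.Semiring.Exp semiring using (_^_; ^-congˡ; ^-assocʳ; ^-homo-*)
open import Algebra.Properties.Semiring.Mult semiring using () renaming (_×_ to _·_)
open import Algebra.Properties.Semiring.Sum semiring using (sum)
open import Algebra.Properties.CommutativeSemiring.Binomial commutativeSemiring using (binomialTerm) renaming (theorem to binomial-theorem)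

-- Half of (1 − u + 2g)² − (1 − u²).
carry : Op → Op → Op
carry u g = n ⊛ n ⊕ n ⊕ (𝟙 ⊕ n) ⊛ (g ⊕ g) ⊕ g ⊛ (g ⊕ g)
  where n = neg u

frobenius-step : ∀ u g → let a = 𝟙 ⊕ neg u ⊕ (g ⊕ g); g′ = carry u g in
  a ⊛ a ≈ 𝟙 ⊕ neg (u ⊛ u) ⊕ (g′ ⊕ g′)
frobenius-step u g f x = begin
    ⟦ a ⊛ a ⟧ f x                              ≡⟨ ℤ.+-identityʳ _ ⟨
    -- Adding n² - u² = 0 yields an identity that holds with -u and -u² as independent variables.
    ⟦ a ⊛ a ⟧ f x + 0ℤ                         ≡⟨ cong (ℤ._+_ (⟦ a ⊛ a ⟧ f x)) n²-u²≡0 ⟨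
    ⟦ a ⊛ a ⊕ (n ⊛ n ⊕ neg (u ⊛ u)) ⟧ f x      ≡⟨ a²+n²+t≈1+t+2g′ n (neg (u ⊛ u)) g f x ⟩
    ⟦ 𝟙 ⊕ neg (u ⊛ u) ⊕ (g′ ⊕ g′) ⟧ f x        ∎
  where
  open import Algebra.Solver.Ring.NaturalCoefficients.Default commutativeSemiring using (solve; _:+_; _:*_; _:=_; con)
  n = neg u
  a = 𝟙 ⊕ n ⊕ (g ⊕ g)
  g′ = carry u g
  n²-u²≡0 : ⟦ n ⊛ n ⊕ neg (u ⊛ u) ⟧ f x ≡ 0ℤ
  n²-u²≡0 = begin
    - ⟦ u ⟧ (⟦ n ⟧ f) x + - ⟦ u ⊛ u ⟧ f x  ≡⟨ cong (λ z → - z + - ⟦ u ⊛ u ⟧ f x) (⟦⟧-neg u (⟦ u ⟧ f) x) ⟩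
    - - ⟦ u ⊛ u ⟧ f x + - ⟦ u ⊛ u ⟧ f x    ≡⟨ ℤ.+-inverseˡ (- ⟦ u ⊛ u ⟧ f x) ⟩
    0ℤ                                     ∎
  -- The solver handles semirings only, so −u is the variable n and −u² the variable t.
  a²+n²+t≈1+t+2g′ : ∀ n t g → (𝟙 ⊕ n ⊕ (g ⊕ g)) ⊛ (𝟙 ⊕ n ⊕ (g ⊕ g)) ⊕ (n ⊛ n ⊕ t) ≈
    𝟙 ⊕ t ⊕ ((n ⊛ n ⊕ n ⊕ (𝟙 ⊕ n) ⊛ (g ⊕ g) ⊕ g ⊛ (g ⊕ g)) ⊕ (n ⊛ n ⊕ n ⊕ (𝟙 ⊕ n) ⊛ (g ⊕ g) ⊕ g ⊛ (g ⊕ g)))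
  a²+n²+t≈1+t+2g′ = solve 3 (λ n t g →
    let a  = con 1 :+ n :+ (g :+ g)
        g′ = n :* n :+ n :+ (con 1 :+ n) :* (g :+ g) :+ g :* (g :+ g)
    in a :* a :+ (n :* n :+ t) := con 1 :+ t :+ (g′ :+ g′)) (λ {_} {_} {_} f x → refl)

⟦⟧-· : ∀ k a g x → ⟦ k · a ⟧ g x ≡ + k * ⟦ a ⟧ g x
⟦⟧-· zero    a g x = refl
⟦⟧-· (suc k) a g x = trans (cong (ℤ._+_ (⟦ a ⟧ g x)) (⟦⟧-· k a g x)) (sym (ℤ.suc-* (+ k) _))

⟦⟧-sum : ∀ {n} (t : Fin n → Op) g x → ⟦ sum t ⟧ g x ≡ Σℤ.sum (λ i → ⟦ t i ⟧ g x)
⟦⟧-sum {zero}  t g x = refl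
⟦⟧-sum {suc n} t g x = cong (ℤ._+_ (⟦ t zero ⟧ g x)) (⟦⟧-sum (λ i → t (suc i)) g x)

∇ : Op
∇ = 𝟙 ⊕ neg E

^-2* : ∀ a n → a ^ (2 ℕ.* n) ≈ a ^ n ⊛ a ^ n
^-2* a n g x = trans (cong (λ k → ⟦ a ^ (n ℕ.+ k) ⟧ g x) (ℕ.+-identityʳ n)) (^-homo-* a n n g x)

-- Repeated squaring: `frobenius-step` turns the square of 1 - E^h + 2g into 1 - E^(2h) + 2g′.
∇^2^ : ∀ α → ∃ λ g → ∇ ^ (2 ℕ.^ α) ≈ 𝟙 ⊕ neg (E ^ (2 ℕ.^ α)) ⊕ (g ⊕ g)
∇^2^ zero    = 𝟘 , λ f x → sym (ℤ.+-identityʳ _)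
∇^2^ (suc α) = g′ , λ f x → begin
    ⟦ ∇ ^ (2 ℕ.* h) ⟧ f x                       ≡⟨ ^-2* ∇ h f x ⟩
    ⟦ ∇ ^ h ⊛ ∇ ^ h ⟧ f x                       ≡⟨ trans (p (⟦ ∇ ^ h ⟧ f) x) (⟦⟧-cong a (p f) x) ⟩
    ⟦ a ⊛ a ⟧ f x                               ≡⟨ frobenius-step (E ^ h) g f x ⟩
    ⟦ 𝟙 ⊕ neg (E ^ h ⊛ E ^ h) ⊕ (g′ ⊕ g′) ⟧ f x    ≡⟨ cong (λ z → f x - z + ⟦ g′ ⊕ g′ ⟧ f x) (^-2* E h f x) ⟨
    ⟦ 𝟙 ⊕ neg (E ^ (2 ℕ.* h)) ⊕ (g′ ⊕ g′) ⟧ f x     ∎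
  where
  h = 2 ℕ.^ α
  g = proj₁ (∇^2^ α)
  p = proj₂ (∇^2^ α)
  a = 𝟙 ⊕ neg (E ^ h) ⊕ (g ⊕ g)
  g′ = carry (E ^ h) g

-- Divisibility in ℤ₍₂₎

Odd : ℤ → Set
Odd x = ∃ λ k → x ≡ 1ℤ + + 2 * k

odd-1 : Odd 1ℤ
odd-1 = 0ℤ , refl

odd-* : ∀ {x y} → Odd x → Odd y → Odd (x * y)
odd-* (j , refl) (k , refl) = j + k + + 2 * (j * k) , lemma j k
  where
  lemma : ∀ j k → (1ℤ + + 2 * j) * (1ℤ + + 2 * k) ≡ 1ℤ + + 2 * (j + k + + 2 * (j * k))
  lemma = solve-∀

infix 4 _∣₂_

-- Divisibility in ℤ₍₂₎ without leaving ℤ: the odd `o` clears the denominator of the quotient.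
_∣₂_ : ℤ → ℤ → Set
a ∣₂ x = ∃ λ o → Odd o × a ∣ o * x

∣⇒∣₂ : ∀ {a x} → a ∣ x → a ∣₂ x
∣⇒∣₂ {x = x} a∣x = 1ℤ , odd-1 , subst (_ ∣_) (sym (ℤ.*-identityˡ x)) a∣x

∣₂-refl : ∀ {a} → a ∣₂ a
∣₂-refl = ∣⇒∣₂ ∣-refl

∣₂-0 : ∀ a → a ∣₂ 0ℤ
∣₂-0 a = ∣⇒∣₂ (divides 0ℤ refl)

∣₂-+ : ∀ {a x y} → a ∣₂ x → a ∣₂ y → a ∣₂ x + y
∣₂-+ {a} {x} {y} (o , oddo , divides p eq) (o′ , oddo′ , divides q eq′) =
  o * o′ , odd-* oddo oddo′ , divides (o′ * p + o * q) (begin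
    o * o′ * (x + y)                ≡⟨ lemma₁ o o′ x y ⟩
    o′ * (o * x) + o * (o′ * y)     ≡⟨ cong₂ (λ s t → o′ * s + o * t) eq eq′ ⟩
    o′ * (p * a) + o * (q * a)      ≡⟨ lemma₂ o o′ p q a ⟩
    (o′ * p + o * q) * a            ∎)
  where
  lemma₁ : ∀ o o′ x y → o * o′ * (x + y) ≡ o′ * (o * x) + o * (o′ * y)
  lemma₁ = solve-∀
  lemma₂ : ∀ o o′ p q a → o′ * (p * a) + o * (q * a) ≡ (o′ * p + o * q) * a
  lemma₂ = solve-∀

∣₂-* : ∀ {a b x y} → a ∣₂ x → b ∣₂ y → a * b ∣₂ x * y
∣₂-* {a} {b} {x} {y} (o , oddo , divides p eq) (o′ , oddo′ , divides q eq′) =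
  o * o′ , odd-* oddo oddo′ , divides (p * q) (begin
    o * o′ * (x * y)     ≡⟨ lemma o o′ x y ⟩
    (o * x) * (o′ * y)   ≡⟨ cong₂ _*_ eq eq′ ⟩
    (p * a) * (q * b)    ≡⟨ lemma p q a b ⟨
    p * q * (a * b)      ∎)
  where
  lemma : ∀ o o′ x y → o * o′ * (x * y) ≡ (o * x) * (o′ * y)
  lemma = solve-∀

∣₂-trans : ∀ {a b c} → a ∣₂ b → b ∣₂ c → a ∣₂ c
∣₂-trans {a} {b} {c} (o , oddo , divides p eq) (o′ , oddo′ , divides q eq′) =
  o * o′ , odd-* oddo oddo′ , divides (q * p) (begin
    o * o′ * c    ≡⟨ ℤ.*-assoc o o′ c ⟩
    o * (o′ * c)  ≡⟨ cong (o *_) eq′ ⟩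
    o * (q * b)   ≡⟨ lemma o q b ⟩
    q * (o * b)   ≡⟨ cong (q *_) eq ⟩
    q * (p * a)   ≡⟨ ℤ.*-assoc q p a ⟨
    q * p * a     ∎)
  where
  lemma : ∀ o q b → o * (q * b) ≡ q * (o * b)
  lemma = solve-∀

∣₂-*ˡ : ∀ {a x} y → a ∣₂ x → a ∣₂ y * x
∣₂-*ˡ {a} y a∣x = subst (_∣₂ y * _) (ℤ.*-identityˡ a) (∣₂-* {1ℤ} (∣⇒∣₂ (divides y (sym (ℤ.*-identityʳ y)))) a∣x)

∣₂-neg : ∀ {a x} → a ∣₂ x → a ∣₂ - x
∣₂-neg {a} {x} a∣x = subst (a ∣₂_) (ℤ.-1*i≡-i x) (∣₂-*ˡ -1ℤ a∣x)

∣₂-cancelˡ : ∀ c .{{_ : ℤ.NonZero c}} {a x} → c * a ∣₂ c * x → a ∣₂ x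
∣₂-cancelˡ c {a} {x} (o , oddo , divides p eq) = o , oddo , divides p
  (ℤ.*-cancelˡ-≡ c (o * x) (p * a) (begin
    c * (o * x)  ≡⟨ lemma c o x ⟩
    o * (c * x)  ≡⟨ eq ⟩
    p * (c * a)  ≡⟨ lemma p c a ⟩
    c * (p * a)  ∎))
  where
  lemma : ∀ c o x → c * (o * x) ≡ o * (c * x)
  lemma = solve-∀

∣₂-cancel-odd : ∀ {o a x} → Odd o → a ∣₂ o * x → a ∣₂ x
∣₂-cancel-odd {o} {a} {x} oddo (o′ , oddo′ , a∣) =
  o′ * o , odd-* oddo′ oddo , subst (a ∣_) (sym (ℤ.*-assoc o′ o x)) a∣

-- Powers of 2 against factorials

[2n]! : ∀ n → ∃ λ k → (2 ℕ.* n) ! ≡ (1 ℕ.+ 2 ℕ.* k) ℕ.* (2 ℕ.^ n ℕ.* n !)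
[2n]! zero    = 0 , refl
-- The factor 2n + 2 supplies 2 (n + 1), and 2n + 1 joins the odd part: the witness comes from (1 +
-- 2n)(1 + 2k).
[2n]! (suc n) with k , eq ← [2n]! n = k ℕ.+ n ℕ.+ 2 ℕ.* (k ℕ.* n) , (begin
    (2 ℕ.* suc n) !                                                      ≡⟨ cong _! (ℕ.*-suc 2 n) ⟩
    (2 ℕ.+ 2 ℕ.* n) ℕ.* ((1 ℕ.+ 2 ℕ.* n) ℕ.* (2 ℕ.* n) !)                ≡⟨ cong (λ z → (2 ℕ.+ 2 ℕ.* n) ℕ.* ((1 ℕ.+ 2 ℕ.* n) ℕ.* z)) eq ⟩
    (2 ℕ.+ 2 ℕ.* n) ℕ.* ((1 ℕ.+ 2 ℕ.* n) ℕ.* ((1 ℕ.+ 2 ℕ.* k) ℕ.* (2 ℕ.^ n ℕ.* n !)))  ≡⟨ lemma n k (2 ℕ.^ n) (n !) ⟩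
    (1 ℕ.+ 2 ℕ.* (k ℕ.+ n ℕ.+ 2 ℕ.* (k ℕ.* n))) ℕ.* (2 ℕ.^ suc n ℕ.* suc n !)  ∎)
  where
  lemma : ∀ n k p f → (2 ℕ.+ 2 ℕ.* n) ℕ.* ((1 ℕ.+ 2 ℕ.* n) ℕ.* ((1 ℕ.+ 2 ℕ.* k) ℕ.* (p ℕ.* f))) ≡
                      (1 ℕ.+ 2 ℕ.* (k ℕ.+ n ℕ.+ 2 ℕ.* (k ℕ.* n))) ℕ.* (2 ℕ.* p ℕ.* ((1 ℕ.+ n) ℕ.* f))
  lemma = ℕ-Solver.solve-∀

odd-1+2* : ∀ k → Odd (+ (1 ℕ.+ 2 ℕ.* k))
odd-1+2* k = + k , cong (ℤ._+_ 1ℤ) (ℤ.pos-* 2 k)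

infix 4 _^2∣!_

-- By Legendre's formula, ord₂ n! is n minus the binary digit sum of n, so this says that n has at
-- least s binary digits 1.
_^2∣!_ : ℕ → ℕ → Set
s ^2∣! n = + (2 ℕ.^ s ℕ.* n !) ∣₂ + (2 ℕ.^ n)

∣₂-*-ℕ : ∀ {a b m n} → + a ∣₂ + m → + b ∣₂ + n → + (a ℕ.* b) ∣₂ + (m ℕ.* n)
∣₂-*-ℕ {a} {b} {m} {n} p q = subst₂ _∣₂_ (sym (ℤ.pos-* a b)) (sym (ℤ.pos-* m n)) (∣₂-* p q)

[2n]!∣₂ : ∀ n → + ((2 ℕ.* n) !) ∣₂ + (2 ℕ.^ n ℕ.* n !)
[2n]!∣₂ n with k , eq ← [2n]! n =
  + (1 ℕ.+ 2 ℕ.* k) , odd-1+2* k , divides 1ℤ (begin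
    + (1 ℕ.+ 2 ℕ.* k) * + (2 ℕ.^ n ℕ.* n !)   ≡⟨ ℤ.pos-* (1 ℕ.+ 2 ℕ.* k) _ ⟨
    + ((1 ℕ.+ 2 ℕ.* k) ℕ.* (2 ℕ.^ n ℕ.* n !)) ≡⟨ cong +_ eq ⟨
    + ((2 ℕ.* n) !)                         ≡⟨ ℤ.*-identityˡ _ ⟨
    1ℤ * + ((2 ℕ.* n) !)                    ∎)

2^[2*n] : ∀ n → 2 ℕ.^ (2 ℕ.* n) ≡ 2 ℕ.^ n ℕ.* 2 ℕ.^ n
2^[2*n] n = trans (cong (λ z → 2 ℕ.^ (n ℕ.+ z)) (ℕ.+-identityʳ n)) (ℕ.^-distribˡ-+-* 2 n n)

-- Appending the digit 0: (2n)! is 2^n n! up to an odd factor, and that 2^n accounts for half of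
-- 2^(2n).
^2∣!-double : ∀ s n → s ^2∣! n → s ^2∣! 2 ℕ.* n
^2∣!-double s n p = ∣₂-trans
  (subst (λ z → + (2 ℕ.^ s ℕ.* (2 ℕ.* n) !) ∣₂ + z) (lemma (2 ℕ.^ s) (2 ℕ.^ n) (n !)) (∣₂-*-ℕ {2 ℕ.^ s} ∣₂-refl ([2n]!∣₂ n)))
  (subst (λ z → + (2 ℕ.^ n ℕ.* (2 ℕ.^ s ℕ.* n !)) ∣₂ + z) (sym (2^[2*n] n)) (∣₂-*-ℕ {2 ℕ.^ n} ∣₂-refl p))
  where
  lemma : ∀ a b c → a ℕ.* (b ℕ.* c) ≡ b ℕ.* (a ℕ.* c)
  lemma = ℕ-Solver.solve-∀

-- Appending the digit 1: the new factor 2n + 1 of the factorial is odd and cancels, while the power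
-- gains a 2.
^2∣!-double+1 : ∀ s n → s ^2∣! n → suc s ^2∣! suc (2 ℕ.* n)
^2∣!-double+1 s n p =
  ∣₂-cancel-odd (odd-1+2* n)
    (subst₂ _∣₂_ (cong +_ (lemma (2 ℕ.^ s) (suc (2 ℕ.* n)) ((2 ℕ.* n) !))) (ℤ.pos-* (suc (2 ℕ.* n)) _)
      (∣₂-*-ℕ {suc (2 ℕ.* n)} ∣₂-refl (∣₂-*-ℕ {2} ∣₂-refl (^2∣!-double s n p))))
  where
  lemma : ∀ a b c → b ℕ.* (2 ℕ.* (a ℕ.* c)) ≡ 2 ℕ.* a ℕ.* (b ℕ.* c)
  lemma = ℕ-Solver.solve-∀

even-or-odd : ∀ n → ∃ λ k → n ≡ 2 ℕ.* k ⊎ n ≡ suc (2 ℕ.* k)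
even-or-odd zero = 0 , inj₁ refl
even-or-odd (suc n) with even-or-odd n
... | k , inj₁ eq = k , inj₂ (cong suc eq)
... | k , inj₂ eq = suc k , inj₁ (trans (cong suc eq) (sym (ℕ.*-suc 2 k)))

-- A positive n has a nonzero digit; strong induction strips the last digit.
1^2∣! : ∀ n → 0 ℕ.< n → 1 ^2∣! n
1^2∣! = <-rec _ go
  where
  go : ∀ n → (∀ {i} → i ℕ.< n → 0 ℕ.< i → 1 ^2∣! i) → 0 ℕ.< n → 1 ^2∣! n
  go n rec 0<n with even-or-odd n
  ... | zero  , inj₁ refl with () ← 0<n
  ... | suc k , inj₁ refl = ^2∣!-double 1 (suc k) (rec (ℕ.m<m+n (suc k) z<s) z<s)
  ... | zero  , inj₂ refl = ∣₂-refl
  -- Here `^2∣!-double+1` gives the stronger `2 ^2∣! n`; one factor 2 is dropped.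
  ... | suc k , inj₂ refl = ∣₂-trans (∣⇒∣₂ (divides (+ 2) (trans (cong +_ (ℕ.*-assoc 2 2 (suc (2 ℕ.* suc k) !))) (ℤ.pos-* 2 (2 ℕ.* suc (2 ℕ.* suc k) !)))))
    (^2∣!-double+1 1 (suc k) (rec (s≤s (ℕ.m≤m+n (suc k) _)) z<s))

-- Strictly between consecutive powers of 2 there is a digit 1 besides the leading one. An even n is
-- halved together with its bounds; for an odd n the last digit counts once and `1^2∣!` covers the
-- rest.
2^2∣! : ∀ e n → 2 ℕ.^ e ℕ.< n → n ℕ.< 2 ℕ.^ suc e → 2 ^2∣! n
2^2∣! zero    n 1<n n<2 with () ← ℕ.<⇒≱ n<2 1<n
2^2∣! (suc e) n 2^e<n n<2^e with even-or-odd n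
... | k , inj₁ refl = ^2∣!-double 2 k (2^2∣! e k (ℕ.*-cancelˡ-< 2 _ _ 2^e<n) (ℕ.*-cancelˡ-< 2 _ _ n<2^e))
... | k , inj₂ refl = ^2∣!-double+1 1 k (1^2∣! k
  (ℕ.≤-trans (ℕ.m^n>0 2 e) (ℕ.*-cancelˡ-≤ 2 (s≤s⁻¹ 2^e<n))))

-- The number 2^e has a single digit 1, so `1^2∣!` is sharp for it. Each doubling contributes the
-- odd factor from `[2n]!`.
2*[2^e]! : ∀ e → ∃ λ k → 2 ℕ.* (2 ℕ.^ e) ! ≡ (1 ℕ.+ 2 ℕ.* k) ℕ.* 2 ℕ.^ (2 ℕ.^ e)
2*[2^e]! zero    = 0 , refl
2*[2^e]! (suc e) with j , p ← 2*[2^e]! e | k , q ← [2n]! (2 ℕ.^ e) = j ℕ.+ k ℕ.+ 2 ℕ.* (j ℕ.* k) , (begin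
    2 ℕ.* (2 ℕ.* n) !                              ≡⟨ cong (2 ℕ.*_) q ⟩
    2 ℕ.* ((1 ℕ.+ 2 ℕ.* k) ℕ.* (2 ℕ.^ n ℕ.* n !))    ≡⟨ lemma₁ k (2 ℕ.^ n) (n !) ⟩
    (1 ℕ.+ 2 ℕ.* k) ℕ.* (2 ℕ.^ n ℕ.* (2 ℕ.* n !))    ≡⟨ cong (λ z → (1 ℕ.+ 2 ℕ.* k) ℕ.* (2 ℕ.^ n ℕ.* z)) p ⟩
    (1 ℕ.+ 2 ℕ.* k) ℕ.* (2 ℕ.^ n ℕ.* ((1 ℕ.+ 2 ℕ.* j) ℕ.* 2 ℕ.^ n))  ≡⟨ lemma₂ j k (2 ℕ.^ n) ⟩
    (1 ℕ.+ 2 ℕ.* (j ℕ.+ k ℕ.+ 2 ℕ.* (j ℕ.* k))) ℕ.* (2 ℕ.^ n ℕ.* 2 ℕ.^ n)  ≡⟨ cong ((1 ℕ.+ 2 ℕ.* (j ℕ.+ k ℕ.+ 2 ℕ.* (j ℕ.* k))) ℕ.*_) (2^[2*n] n) ⟨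
    (1 ℕ.+ 2 ℕ.* (j ℕ.+ k ℕ.+ 2 ℕ.* (j ℕ.* k))) ℕ.* 2 ℕ.^ (2 ℕ.* n)      ∎)
  where
  n = 2 ℕ.^ e
  lemma₁ : ∀ k p f → 2 ℕ.* ((1 ℕ.+ 2 ℕ.* k) ℕ.* (p ℕ.* f)) ≡ (1 ℕ.+ 2 ℕ.* k) ℕ.* (p ℕ.* (2 ℕ.* f))
  lemma₁ = ℕ-Solver.solve-∀
  lemma₂ : ∀ j k p → (1 ℕ.+ 2 ℕ.* k) ℕ.* (p ℕ.* ((1 ℕ.+ 2 ℕ.* j) ℕ.* p)) ≡ (1 ℕ.+ 2 ℕ.* (j ℕ.+ k ℕ.+ 2 ℕ.* (j ℕ.* k))) ℕ.* (p ℕ.* p)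
  lemma₂ = ℕ-Solver.solve-∀

-- Differences of f and of its restriction to even arguments

Δ : Op
Δ = E ⊕ neg 𝟙

-- Leibniz rule; only two terms occur because the second difference of t - a vanishes.
Δ^-linear* : ∀ j f a x → ⟦ Δ ^ suc j ⟧ (λ t → f t * (t - a)) x ≡
             ⟦ Δ ^ suc j ⟧ f x * (x - a) + + suc j * ⟦ Δ ^ j ⟧ f (1ℤ + x)
Δ^-linear* zero f a x = lemma (f (1ℤ + x)) (f x) x a
  where
  lemma : ∀ f′ f x a → f′ * (1ℤ + x - a) + - (f * (x - a)) ≡ (f′ + - f) * (x - a) + 1ℤ * f′
  lemma = solve-∀
Δ^-linear* (suc j) f a x = begin
  ⟦ Δ ^ suc j ⟧ F (1ℤ + x) - ⟦ Δ ^ suc j ⟧ F x                           ≡⟨ cong₂ _-_ (Δ^-linear* j f a (1ℤ + x)) (Δ^-linear* j f a x) ⟩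
  (p″ - p′) * (1ℤ + x - a) + + suc j * p″ - ((p′ - p) * (x - a) + + suc j * p′)  ≡⟨ lemma p″ p′ p x a (+ suc j) ⟩
  ((p″ - p′) - (p′ - p)) * (x - a) + (1ℤ + + suc j) * (p″ - p′)            ∎
  where
  F = λ t → f t * (t - a)
  p″ = ⟦ Δ ^ j ⟧ f (1ℤ + (1ℤ + x))
  p′ = ⟦ Δ ^ j ⟧ f (1ℤ + x)
  p = ⟦ Δ ^ j ⟧ f x
  lemma : ∀ p″ p′ p x a j → (p″ - p′) * (1ℤ + x - a) + j * p″ - ((p′ - p) * (x - a) + j * p′) ≡
          ((p″ - p′) - (p′ - p)) * (x - a) + (1ℤ + j) * (p″ - p′)
  lemma = solve-∀

Δ^-const : ∀ j c x → ⟦ Δ ^ suc j ⟧ (λ _ → c) x ≡ 0ℤ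
Δ^-const zero    c x = ℤ.+-inverseʳ c
Δ^-const (suc j) c x = cong₂ _-_ (Δ^-const j c (1ℤ + x)) (Δ^-const j c x)

-- This is 2^l l! times the binomial coefficient of t/2 over l, the normalisation that occurs in
-- `T`.
falling₂ : ℕ → ℤ → ℤ
falling₂ zero    t = 1ℤ
falling₂ (suc l) t = falling₂ l t * (t - + (2 ℕ.* l))

+suc! : ∀ j → + (suc j !) ≡ + suc j * + (j !)
+suc! j = ℤ.pos-* (suc j) (j !)

-- In the Leibniz rule, the second term carries the factor j + 1 that extends j! to (j + 1)!.
j!∣Δ^j-falling₂ : ∀ l j x → + (j !) ∣ ⟦ Δ ^ j ⟧ (falling₂ l) x
j!∣Δ^j-falling₂ l       zero    x = divides (falling₂ l x) (sym (ℤ.*-identityʳ _))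
j!∣Δ^j-falling₂ zero    (suc j) x = divides 0ℤ (Δ^-const j 1ℤ x)
j!∣Δ^j-falling₂ (suc l) (suc j) x = subst (_ ∣_) (sym (Δ^-linear* j (falling₂ l) (+ (2 ℕ.* l)) x))
  (∣m∣n⇒∣m+n
    (subst (_ ∣_) (ℤ.*-comm (x - + (2 ℕ.* l)) _) (∣n⇒∣m*n (x - + (2 ℕ.* l)) (j!∣Δ^j-falling₂ l (suc j) x)))
    (subst (_∣ + suc j * ⟦ Δ ^ j ⟧ (falling₂ l) (1ℤ + x)) (sym (+suc! j)) (*-monoʳ-∣ (+ suc j) (j!∣Δ^j-falling₂ l j (1ℤ + x)))))

Δ^-falling₂-> : ∀ l j x → l ℕ.< j → ⟦ Δ ^ j ⟧ (falling₂ l) x ≡ 0ℤ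
Δ^-falling₂-> zero    (suc j) x l<j = Δ^-const j 1ℤ x
Δ^-falling₂-> (suc l) (suc j) x l<j = begin
  ⟦ Δ ^ suc j ⟧ (falling₂ (suc l)) x  ≡⟨ Δ^-linear* j (falling₂ l) (+ (2 ℕ.* l)) x ⟩
  _                                   ≡⟨ cong₂ (λ y z → y * (x - + (2 ℕ.* l)) + + suc j * z) (Δ^-falling₂-> l (suc j) x (ℕ.<-trans (ℕ.n<1+n l) l<j)) (Δ^-falling₂-> l j (1ℤ + x) (s≤s⁻¹ l<j)) ⟩
  0ℤ * (x - + (2 ℕ.* l)) + + suc j * 0ℤ  ≡⟨ cong (ℤ._+_ 0ℤ) (ℤ.*-zeroʳ (+ suc j)) ⟩
  0ℤ                                  ∎

Δ^l-falling₂ : ∀ l x → ⟦ Δ ^ l ⟧ (falling₂ l) x ≡ + (l !)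
Δ^l-falling₂ zero    x = refl
Δ^l-falling₂ (suc l) x = begin
  ⟦ Δ ^ suc l ⟧ (falling₂ (suc l)) x  ≡⟨ Δ^-linear* l (falling₂ l) (+ (2 ℕ.* l)) x ⟩
  _                                   ≡⟨ cong₂ (λ y z → y * (x - + (2 ℕ.* l)) + + suc l * z) (Δ^-falling₂-> l (suc l) x ℕ.≤-refl) (Δ^l-falling₂ l (1ℤ + x)) ⟩
  0ℤ + + suc l * + (l !)              ≡⟨ ℤ.+-identityˡ _ ⟩
  + suc l * + (l !)                   ≡⟨ +suc! l ⟨
  + (suc l !)                         ∎

-- The absolute value preserves parity and so makes sense of (-1)^x for negative x.
σ : ℤ → ℤ
σ x = -1ℤ ℤ.^ ℤ.∣ x ∣

σ-suc : ∀ x → σ (1ℤ + x) ≡ - σ x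
σ-suc (+ n)           = ℤ.-1*i≡-i (σ (+ n))
σ-suc -[1+ zero ]     = refl
σ-suc -[1+ suc n ]    = begin
  σ -[1+ n ]                   ≡⟨ ℤ.neg-involutive _ ⟨
  - - σ -[1+ n ]               ≡⟨ cong -_ (ℤ.-1*i≡-i (σ -[1+ n ])) ⟨
  - (-1ℤ * σ -[1+ n ])         ∎

-- Since σ changes sign under `E`, moving it past 1 - E leaves 1 + E = 2 + Δ.
∇^-σ : ∀ m f x → ⟦ ∇ ^ m ⟧ (λ t → σ t * f t) x ≡ σ x * ⟦ (𝟙 ⊕ 𝟙 ⊕ Δ) ^ m ⟧ f x
∇^-σ zero    f x = refl
∇^-σ (suc m) f x = begin
  ⟦ ∇ ^ m ⟧ F x - ⟦ ∇ ^ m ⟧ F (1ℤ + x)  ≡⟨ cong₂ _-_ (∇^-σ m f x) (∇^-σ m f (1ℤ + x)) ⟩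
  σ x * p - σ (1ℤ + x) * p′             ≡⟨ cong (λ s → σ x * p - s * p′) (σ-suc x) ⟩
  σ x * p - (- σ x) * p′                ≡⟨ lemma (σ x) p p′ ⟩
  σ x * (p + p + (p′ + - p))            ∎
  where
  F = λ t → σ t * f t
  p = ⟦ (𝟙 ⊕ 𝟙 ⊕ Δ) ^ m ⟧ f x
  p′ = ⟦ (𝟙 ⊕ 𝟙 ⊕ Δ) ^ m ⟧ f (1ℤ + x)
  lemma : ∀ s p p′ → s * p - (- s) * p′ ≡ s * (p + p + (p′ + - p))
  lemma = solve-∀

∇^≡±Δ^ : ∀ m f x → ⟦ ∇ ^ m ⟧ f x ≡ -1ℤ ℤ.^ m * ⟦ Δ ^ m ⟧ f x
∇^≡±Δ^ zero    f x = sym (ℤ.*-identityˡ (f x))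
∇^≡±Δ^ (suc m) f x = begin
  ⟦ ∇ ^ m ⟧ f x - ⟦ ∇ ^ m ⟧ f (1ℤ + x)  ≡⟨ cong₂ _-_ (∇^≡±Δ^ m f x) (∇^≡±Δ^ m f (1ℤ + x)) ⟩
  s * p - s * p′                        ≡⟨ lemma s p p′ ⟩
  -1ℤ * s * (p′ + - p)                  ∎
  where
  s = -1ℤ ℤ.^ m
  p = ⟦ Δ ^ m ⟧ f x
  p′ = ⟦ Δ ^ m ⟧ f (1ℤ + x)
  lemma : ∀ s p p′ → s * p - s * p′ ≡ -1ℤ * s * (p′ + - p)
  lemma = solve-∀

double-^ : ∀ a i f x → ⟦ (a ⊕ a) ^ i ⟧ f x ≡ + (2 ℕ.^ i) * ⟦ a ^ i ⟧ f x
double-^ a zero    f x = sym (ℤ.*-identityˡ (f x))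
double-^ a (suc i) f x = begin
  ⟦ a ⟧ (⟦ (a ⊕ a) ^ i ⟧ f) x + ⟦ a ⟧ (⟦ (a ⊕ a) ^ i ⟧ f) x  ≡⟨ cong (λ z → z + z) (trans (⟦⟧-cong a (double-^ a i f) x) (⟦⟧-* a c (⟦ a ^ i ⟧ f) x)) ⟩
  c * y + c * y                                              ≡⟨ lemma c y ⟩
  + 2 * c * y                                                ≡⟨ cong (_* y) (ℤ.pos-* 2 (2 ℕ.^ i)) ⟨
  + (2 ℕ.^ suc i) * y                                        ∎
  where
  c = + (2 ℕ.^ i)
  y = ⟦ a ^ suc i ⟧ f x
  lemma : ∀ c y → c * y + c * y ≡ + 2 * c * y
  lemma = solve-∀

𝟙^ : ∀ i f x → ⟦ 𝟙 ^ i ⟧ f x ≡ f x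
𝟙^ zero    f x = refl
𝟙^ (suc i) f x = 𝟙^ i f x

⟦binomial⟧ : ∀ a b n f x → ⟦ (a ⊕ b) ^ n ⟧ f x ≡
  Σℤ.sum {suc n} (λ i → + (n C toℕ i) * ⟦ a ^ toℕ i ⟧ (⟦ b ^ (n ℕ.∸ toℕ i) ⟧ f) x)
⟦binomial⟧ a b n f x = begin
  ⟦ (a ⊕ b) ^ n ⟧ f x                                          ≡⟨ binomial-theorem n a b f x ⟩
  ⟦ sum (binomialTerm a b n) ⟧ f x                             ≡⟨ ⟦⟧-sum (binomialTerm a b n) f x ⟩
  Σℤ.sum {suc n} (λ i → ⟦ binomialTerm a b n i ⟧ f x)          ≡⟨ Σℤ.sum-cong-≗ {suc n} (λ i → ⟦⟧-· (n C toℕ i) (a ^ toℕ i ⊛ b ^ (n ℕ.∸ toℕ i)) f x) ⟩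
  _                                                            ∎

nCk*k!*[n∸k]! : ∀ {n k} → k ℕ.≤ n → (n C k) ℕ.* (k ! ℕ.* (n ℕ.∸ k) !) ≡ n !
nCk*k!*[n∸k]! {n} {k} k≤n = trans (cong (ℕ._* (k ! ℕ.* (n ℕ.∸ k) !)) (nCk≡n!/k![n-k]! k≤n)) (ℕ.m/n*n≡m {{ℕ._!*_!≢0 k (n ℕ.∸ k)}} (k![n∸k]!∣n! k≤n))

-- The binomial coefficient completes k! (n - k)! to n!, and the surplus factor `c` is carried
-- along.
binomialTerm-∣₂ : ∀ c {n k u v} → k ℕ.≤ n → + (c ℕ.* k !) ∣₂ u → + ((n ℕ.∸ k) !) ∣₂ v →
                  + (c ℕ.* n !) ∣₂ + (n C k) * (u * v)
binomialTerm-∣₂ c {n} {k} {u} {v} k≤n p q =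
  subst (_∣₂ + (n C k) * (u * v)) (begin
    + (n C k) * (+ (c ℕ.* k !) * + ((n ℕ.∸ k) !))  ≡⟨ cong (+ (n C k) *_) (sym (ℤ.pos-* (c ℕ.* k !) ((n ℕ.∸ k) !))) ⟩
    + (n C k) * + (c ℕ.* k ! ℕ.* (n ℕ.∸ k) !)      ≡⟨ ℤ.pos-* (n C k) _ ⟨
    + ((n C k) ℕ.* (c ℕ.* k ! ℕ.* (n ℕ.∸ k) !))    ≡⟨ cong +_ (lemma (n C k) c (k !) ((n ℕ.∸ k) !)) ⟩
    + (c ℕ.* ((n C k) ℕ.* (k ! ℕ.* (n ℕ.∸ k) !)))  ≡⟨ cong (λ z → + (c ℕ.* z)) (nCk*k!*[n∸k]! k≤n) ⟩
    + (c ℕ.* n !)                                  ∎)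
  (∣₂-* {+ (n C k)} ∣₂-refl (∣₂-* p q))
  where
  lemma : ∀ a c x y → a ℕ.* (c ℕ.* x ℕ.* y) ≡ c ℕ.* (a ℕ.* (x ℕ.* y))
  lemma = ℕ-Solver.solve-∀

∣₂-sum : ∀ {a n} (t : Fin n → ℤ) → (∀ i → a ∣₂ t i) → a ∣₂ Σℤ.sum t
∣₂-sum {a} {zero}  t p = ∣₂-0 a
∣₂-sum {a} {suc n} t p = ∣₂-+ (p zero) (∣₂-sum (λ i → t (suc i)) (λ i → p (suc i)))

2∣±1±1 : ∀ m n → + 2 ∣ -1ℤ ℤ.^ m + -1ℤ ℤ.^ n
2∣±1±1 m n = lemma (sign m) (sign n)
  where
  sign : ∀ n → -1ℤ ℤ.^ n ≡ 1ℤ ⊎ -1ℤ ℤ.^ n ≡ -1ℤ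
  sign zero = inj₁ refl
  sign (suc n) with sign n
  ... | inj₁ eq = inj₂ (cong (-1ℤ *_) eq)
  ... | inj₂ eq = inj₁ (cong (-1ℤ *_) eq)
  lemma : ∀ {s t} → s ≡ 1ℤ ⊎ s ≡ -1ℤ → t ≡ 1ℤ ⊎ t ≡ -1ℤ → + 2 ∣ s + t
  lemma (inj₁ refl) (inj₁ refl) = divides 1ℤ refl
  lemma (inj₁ refl) (inj₂ refl) = divides 0ℤ refl
  lemma (inj₂ refl) (inj₁ refl) = divides 0ℤ refl
  lemma (inj₂ refl) (inj₂ refl) = divides -1ℤ refl

-- Divisibility of the differences of `q`

module _ (l : ℕ) (q : ℤ → ℤ) (2q≡f+σf : ∀ y → + 2 * q y ≡ falling₂ l y + σ y * falling₂ l y) where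

  private
    f = falling₂ l

    term : ℕ → ℤ → ℕ → ℤ
    term m x i = + (m C i) * (+ (2 ℕ.^ i) * ⟦ Δ ^ (m ℕ.∸ i) ⟧ f x)

  -- Doubling expresses `q` through f and σ f. On f, `∇ ^ m` is ±Δ^m; moving σ out of the second
  -- part leaves (2 + Δ)^m, which is expanded in powers of 2.
  2∇^q : ∀ m x → + 2 * ⟦ ∇ ^ m ⟧ q x ≡
         -1ℤ ℤ.^ m * ⟦ Δ ^ m ⟧ f x + σ x * Σℤ.sum {suc m} (λ i → term m x (toℕ i))
  2∇^q m x = begin
    + 2 * ⟦ ∇ ^ m ⟧ q x                             ≡⟨ ⟦⟧-* (∇ ^ m) (+ 2) q x ⟨
    ⟦ ∇ ^ m ⟧ (λ y → + 2 * q y) x                   ≡⟨ ⟦⟧-cong (∇ ^ m) 2q≡f+σf x ⟩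
    ⟦ ∇ ^ m ⟧ (λ y → f y + σ y * f y) x             ≡⟨ ⟦⟧-+ (∇ ^ m) f (λ y → σ y * f y) x ⟩
    ⟦ ∇ ^ m ⟧ f x + ⟦ ∇ ^ m ⟧ (λ y → σ y * f y) x   ≡⟨ cong₂ _+_ (∇^≡±Δ^ m f x) (∇^-σ m f x) ⟩
    -1ℤ ℤ.^ m * ⟦ Δ ^ m ⟧ f x + σ x * ⟦ (𝟙 ⊕ 𝟙 ⊕ Δ) ^ m ⟧ f x
      ≡⟨ cong (λ z → -1ℤ ℤ.^ m * ⟦ Δ ^ m ⟧ f x + σ x * z) (trans (⟦binomial⟧ (𝟙 ⊕ 𝟙) Δ m f x) (Σℤ.sum-cong-≗ {suc m} 2^)) ⟩
    -1ℤ ℤ.^ m * ⟦ Δ ^ m ⟧ f x + σ x * Σℤ.sum {suc m} (λ i → term m x (toℕ i))  ∎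
    where
    2^ : ∀ i → + (m C toℕ i) * ⟦ (𝟙 ⊕ 𝟙) ^ toℕ i ⟧ (⟦ Δ ^ (m ℕ.∸ toℕ i) ⟧ f) x ≡ term m x (toℕ i)
    2^ i = cong (+ (m C toℕ i) *_) (trans (double-^ 𝟙 (toℕ i) (⟦ Δ ^ (m ℕ.∸ toℕ i) ⟧ f) x)
             (cong (+ (2 ℕ.^ toℕ i) *_) (𝟙^ (toℕ i) (⟦ Δ ^ (m ℕ.∸ toℕ i) ⟧ f) x)))

  -- In `2∇^q` the term i = 0 combines with the first summand to (±1 + σ x) Δ^m f, an even multiple
  -- of a multiple of m!. The terms with i ≥ 1 gain their factor 2 from `1^2∣!`. Hence 2 m! divides
  -- the doubled difference.
  m!∣₂∇^m : ∀ m x → + (m !) ∣₂ ⟦ ∇ ^ m ⟧ q x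
  m!∣₂∇^m m x = ∣₂-cancelˡ (+ 2) (subst₂ _∣₂_ (ℤ.pos-* 2 (m !)) (sym eq)
    (∣₂-+ (subst (_∣₂ (s + σ x) * D) (sym (ℤ.pos-* 2 (m !)))
             (∣₂-* {+ 2} (∣⇒∣₂ (2∣±1±1 m ℤ.∣ x ∣)) (∣⇒∣₂ (j!∣Δ^j-falling₂ l m x))))
          (∣₂-*ˡ (σ x) (∣₂-sum {n = m} (λ i → term m x (suc (toℕ i))) (λ i →
            binomialTerm-∣₂ 2 {k = suc (toℕ i)} (Fin.toℕ<n i) (1^2∣! (suc (toℕ i)) z<s) (∣⇒∣₂ (j!∣Δ^j-falling₂ l (m ℕ.∸ suc (toℕ i)) x)))))))
    where
    s = -1ℤ ℤ.^ m
    D = ⟦ Δ ^ m ⟧ f x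
    S = Σℤ.sum {m} (λ i → term m x (suc (toℕ i)))
    lemma : ∀ s t D S → s * D + t * (1ℤ * (1ℤ * D) + S) ≡ (s + t) * D + t * S
    lemma = solve-∀
    eq : + 2 * ⟦ ∇ ^ m ⟧ q x ≡ (s + σ x) * D + σ x * S
    eq = trans (2∇^q m x) (lemma s (σ x) D S)

  module _ (e d : ℕ) (d<2^e : d ℕ.< 2 ℕ.^ e) (l≤d : l ℕ.≤ d) (x : ℤ) where

    private
      m = 2 ℕ.^ e ℕ.+ d

      2^e<1+m : 2 ℕ.^ e ℕ.< suc m
      2^e<1+m = s≤s (ℕ.m≤m+n (2 ℕ.^ e) d)

      i₀ : Fin (suc m)
      i₀ = fromℕ< 2^e<1+m

      l<m : l ℕ.< m
      l<m = ℕ.<-≤-trans (ℕ.≤-<-trans l≤d d<2^e) (ℕ.m≤m+n (2 ℕ.^ e) d)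

      m∸2^e≡d : m ℕ.∸ 2 ℕ.^ e ≡ d
      m∸2^e≡d = ℕ.m+n∸m≡n (2 ℕ.^ e) d

    term-2^e : term m x (2 ℕ.^ e) ≡ + (m C 2 ℕ.^ e) * (+ (2 ℕ.^ 2 ℕ.^ e) * ⟦ Δ ^ d ⟧ f x)
    term-2^e = cong (λ j → + (m C 2 ℕ.^ e) * (+ (2 ℕ.^ 2 ℕ.^ e) * ⟦ Δ ^ j ⟧ f x)) m∸2^e≡d

    -- For i > 2^e the bound i ≤ m < 2^(e+1) makes `2^2∣!` applicable; for i < 2^e the order m - i
    -- exceeds d ≥ l, so the difference of f vanishes.
    4m!∣₂term : ∀ i → i ℕ.≤ m → i ≢ 2 ℕ.^ e → + (4 ℕ.* m !) ∣₂ term m x i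
    4m!∣₂term i i≤m i≢2^e with ℕ.<-cmp i (2 ℕ.^ e)
    ... | tri≈ _ i≡2^e _ = contradiction i≡2^e i≢2^e
    ... | tri> _ _ 2^e<i = binomialTerm-∣₂ 4 i≤m
            (2^2∣! e i 2^e<i (ℕ.≤-<-trans i≤m (ℕ.+-monoʳ-< (2 ℕ.^ e) (ℕ.<-≤-trans d<2^e (ℕ.≤-reflexive (sym (ℕ.+-identityʳ _)))))))
            (∣⇒∣₂ (j!∣Δ^j-falling₂ l (m ℕ.∸ i) x))
    ... | tri< i<2^e _ _ = subst (+ (4 ℕ.* m !) ∣₂_) (sym (begin
        + (m C i) * (+ (2 ℕ.^ i) * ⟦ Δ ^ (m ℕ.∸ i) ⟧ f x)  ≡⟨ cong (λ z → + (m C i) * (+ (2 ℕ.^ i) * z)) (Δ^-falling₂-> l (m ℕ.∸ i) x l<m∸i) ⟩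
        + (m C i) * (+ (2 ℕ.^ i) * 0ℤ)                     ≡⟨ cong (+ (m C i) *_) (ℤ.*-zeroʳ (+ (2 ℕ.^ i))) ⟩
        + (m C i) * 0ℤ                                     ≡⟨ ℤ.*-zeroʳ (+ (m C i)) ⟩
        0ℤ                                                 ∎)) (∣₂-0 _)
      where
      l<m∸i : l ℕ.< m ℕ.∸ i
      l<m∸i = ℕ.≤-<-trans l≤d (subst (ℕ._< m ℕ.∸ i) m∸2^e≡d (ℕ.∸-monoʳ-< i<2^e (ℕ.m≤m+n (2 ℕ.^ e) d)))

    2∇^m≡ : + 2 * ⟦ ∇ ^ m ⟧ q x ≡ σ x * term m x (2 ℕ.^ e) + σ x * Σℤ.sum (removeAt (λ i → term m x (toℕ i)) i₀)
    2∇^m≡ = begin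
      + 2 * ⟦ ∇ ^ m ⟧ q x  ≡⟨ 2∇^q m x ⟩
      -- The degree l of f is below m, which kills the first summand; the term i = 2^e is then split
      -- off.
      s * ⟦ Δ ^ m ⟧ f x + σ x * Σℤ.sum t  ≡⟨ cong₂ (λ y z → s * y + σ x * z) (Δ^-falling₂-> l m x l<m) (Σℤ.sum-remove {i = i₀} t) ⟩
      s * 0ℤ + σ x * (t i₀ + R)           ≡⟨ lemma s (σ x) (t i₀) R ⟩
      σ x * t i₀ + σ x * R                ≡⟨ cong (λ k → σ x * term m x k + σ x * R) (Fin.toℕ-fromℕ< 2^e<1+m) ⟩
      σ x * term m x (2 ℕ.^ e) + σ x * R  ∎
      where
      s = -1ℤ ℤ.^ m
      t : Fin (suc m) → ℤ
      t i = term m x (toℕ i)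
      R = Σℤ.sum (removeAt t i₀)
      lemma : ∀ s t a b → s * 0ℤ + t * (a + b) ≡ t * a + t * b
      lemma = solve-∀

    -- Reduces the congruence to the single surviving term; the modulus is 4 m! because everything
    -- has been doubled.
    2m!∣₂∇^m- : ∀ z → + (4 ℕ.* m !) ∣₂ σ x * term m x (2 ℕ.^ e) - + 2 * z → + (2 ℕ.* m !) ∣₂ ⟦ ∇ ^ m ⟧ q x - z
    2m!∣₂∇^m- z p = ∣₂-cancelˡ (+ 2) (subst₂ _∣₂_ (trans (cong +_ (ℕ.*-assoc 2 2 (m !))) (ℤ.pos-* 2 (2 ℕ.* m !))) eq
      (∣₂-+ p (∣₂-*ˡ (σ x) (∣₂-sum (removeAt t i₀) (λ i → 4m!∣₂term (toℕ (punchIn i₀ i)) (s≤s⁻¹ (Fin.toℕ<n (punchIn i₀ i)))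
        (λ eq → Fin.punchInᵢ≢i i₀ i (Fin.toℕ-injective (trans eq (sym (Fin.toℕ-fromℕ< 2^e<1+m))))))))))
      where
      t : Fin (suc m) → ℤ
      t i = term m x (toℕ i)
      R = Σℤ.sum (removeAt t i₀)
      lemma : ∀ a b z → a - + 2 * z + b ≡ (a + b) - + 2 * z
      lemma = solve-∀
      lemma′ : ∀ a z → + 2 * a - + 2 * z ≡ + 2 * (a - z)
      lemma′ = solve-∀
      eq : σ x * term m x (2 ℕ.^ e) - + 2 * z + σ x * R ≡ + 2 * (⟦ ∇ ^ m ⟧ q x - z)
      eq = begin
        σ x * term m x (2 ℕ.^ e) - + 2 * z + σ x * R    ≡⟨ lemma (σ x * term m x (2 ℕ.^ e)) (σ x * R) z ⟩
        (σ x * term m x (2 ℕ.^ e) + σ x * R) - + 2 * z  ≡⟨ cong (_- + 2 * z) 2∇^m≡ ⟨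
        + 2 * ⟦ ∇ ^ m ⟧ q x - + 2 * z                   ≡⟨ lemma′ (⟦ ∇ ^ m ⟧ q x) z ⟩
        + 2 * (⟦ ∇ ^ m ⟧ q x - z)                       ∎

    -- Now l < d, so the surviving term contains Δ^d f = 0.
    2m!∣₂∇^m : l ≢ d → + (2 ℕ.* m !) ∣₂ ⟦ ∇ ^ m ⟧ q x - 0ℤ
    2m!∣₂∇^m l≢d = 2m!∣₂∇^m- 0ℤ (subst (+ (4 ℕ.* m !) ∣₂_) (sym (begin
      σ x * term m x (2 ℕ.^ e) - + 2 * 0ℤ    ≡⟨ cong (λ z → σ x * z - + 2 * 0ℤ) term-2^e ⟩
      σ x * (K * (P * ⟦ Δ ^ d ⟧ f x)) - + 2 * 0ℤ  ≡⟨ cong (λ z → σ x * (K * (P * z)) - + 2 * 0ℤ) (Δ^-falling₂-> l d x (ℕ.≤∧≢⇒< l≤d l≢d)) ⟩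
      σ x * (K * (P * 0ℤ)) - + 2 * 0ℤ        ≡⟨ lemma (σ x) K P ⟩
      0ℤ                                     ∎)) (∣₂-0 _))
      where
      K = + (m C 2 ℕ.^ e)
      P = + (2 ℕ.^ 2 ℕ.^ e)
      lemma : ∀ s K P → s * (K * (P * 0ℤ)) - + 2 * 0ℤ ≡ 0ℤ
      lemma = solve-∀

    -- With Δ^d f = d!, the odd number o = 2 (2^e)! / 2^(2^e) turns the surviving term into σ x · 2
    -- m!. After multiplication by o, the difference from 2 m! is therefore (σ x - o) · 2 m!, and σ
    -- x - o is even.
    2m!∣₂∇^m-m! : l ≡ d → + (2 ℕ.* m !) ∣₂ ⟦ ∇ ^ m ⟧ q x - + (m !)
    2m!∣₂∇^m-m! refl = 2m!∣₂∇^m- (+ (m !)) (∣₂-cancel-odd (odd-1+2* k) (subst₂ _∣₂_ (sym (trans (cong +_ (ℕ.*-assoc 2 2 (m !))) (trans (ℤ.pos-* 2 (2 ℕ.* m !)) (cong (+ 2 *_) (ℤ.pos-* 2 (m !)))))) (sym eq)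
      (∣₂-* (∣⇒∣₂ 2∣σ-o) (∣₂-refl {+ 2 * + (m !)}))))
      where
      k = proj₁ (2*[2^e]! e)
      o = + (1 ℕ.+ 2 ℕ.* k)
      K = + (m C 2 ℕ.^ e)
      P = + (2 ℕ.^ 2 ℕ.^ e)
      D = + (d !)
      F = + ((2 ℕ.^ e) !)
      oP≡2F : o * P ≡ + 2 * F
      oP≡2F = begin
        o * P                                        ≡⟨ ℤ.pos-* (1 ℕ.+ 2 ℕ.* k) (2 ℕ.^ 2 ℕ.^ e) ⟨
        + ((1 ℕ.+ 2 ℕ.* k) ℕ.* 2 ℕ.^ 2 ℕ.^ e)        ≡⟨ cong +_ (proj₂ (2*[2^e]! e)) ⟨
        + (2 ℕ.* (2 ℕ.^ e) !)                        ≡⟨ ℤ.pos-* 2 ((2 ℕ.^ e) !) ⟩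
        + 2 * F                                      ∎
      KFD≡m! : K * (F * D) ≡ + (m !)
      KFD≡m! = begin
        K * (F * D)                                         ≡⟨ cong (K *_) (ℤ.pos-* ((2 ℕ.^ e) !) (d !)) ⟨
        K * + ((2 ℕ.^ e) ! ℕ.* d !)                         ≡⟨ ℤ.pos-* (m C 2 ℕ.^ e) ((2 ℕ.^ e) ! ℕ.* d !) ⟨
        + ((m C 2 ℕ.^ e) ℕ.* ((2 ℕ.^ e) ! ℕ.* d !))         ≡⟨ cong (λ j → + ((m C 2 ℕ.^ e) ℕ.* ((2 ℕ.^ e) ! ℕ.* j !))) m∸2^e≡d ⟨
        + ((m C 2 ℕ.^ e) ℕ.* ((2 ℕ.^ e) ! ℕ.* (m ℕ.∸ 2 ℕ.^ e) !))  ≡⟨ cong +_ (nCk*k!*[n∸k]! (ℕ.m≤m+n (2 ℕ.^ e) d)) ⟩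
        + (m !)                                             ∎
      2∣σ-o : + 2 ∣ σ x - o
      2∣σ-o = subst (+ 2 ∣_) (trans (lemma (σ x) (+ k)) (cong (λ z → σ x - (1ℤ + z)) (sym (ℤ.pos-* 2 k))))
        (∣m∣n⇒∣m+n (2∣±1±1 ℤ.∣ x ∣ 1) (divides (- + k) refl))
        where
        lemma : ∀ s k → (s + -1ℤ * 1ℤ) + (- k) * + 2 ≡ s - (1ℤ + + 2 * k)
        lemma = solve-∀
      lemma₁ : ∀ o s K P D M → o * (s * (K * (P * D)) - + 2 * M) ≡ s * (K * (o * P * D)) - o * (+ 2 * M)
      lemma₁ = solve-∀
      lemma₂ : ∀ o s K F D M → s * (K * (+ 2 * F * D)) - o * (+ 2 * M) ≡ s * (+ 2 * (K * (F * D))) - o * (+ 2 * M)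
      lemma₂ = solve-∀
      lemma₃ : ∀ o s M → s * (+ 2 * M) - o * (+ 2 * M) ≡ (s - o) * (+ 2 * M)
      lemma₃ = solve-∀
      eq : o * (σ x * term m x (2 ℕ.^ e) - + 2 * + (m !)) ≡ (σ x - o) * (+ 2 * + (m !))
      eq = begin
        o * (σ x * term m x (2 ℕ.^ e) - + 2 * + (m !))         ≡⟨ cong (λ z → o * (σ x * z - + 2 * + (m !))) term-2^e ⟩
        o * (σ x * (K * (P * ⟦ Δ ^ d ⟧ f x)) - + 2 * + (m !))  ≡⟨ cong (λ z → o * (σ x * (K * (P * z)) - + 2 * + (m !))) (Δ^l-falling₂ l x) ⟩
        o * (σ x * (K * (P * D)) - + 2 * + (m !))              ≡⟨ lemma₁ o (σ x) K P D (+ (m !)) ⟩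
        σ x * (K * (o * P * D)) - o * (+ 2 * + (m !))          ≡⟨ cong (λ z → σ x * (K * (z * D)) - o * (+ 2 * + (m !))) oP≡2F ⟩
        σ x * (K * (+ 2 * F * D)) - o * (+ 2 * + (m !))        ≡⟨ lemma₂ o (σ x) K F D (+ (m !)) ⟩
        σ x * (+ 2 * (K * (F * D))) - o * (+ 2 * + (m !))      ≡⟨ cong (λ z → σ x * (+ 2 * z) - o * (+ 2 * + (m !))) KFD≡m! ⟩
        σ x * (+ 2 * + (m !)) - o * (+ 2 * + (m !))            ≡⟨ lemma₃ o (σ x) (+ (m !)) ⟩
        (σ x - o) * (+ 2 * + (m !))                            ∎

-- Reduction from 1 − E to 1 − E^h

⟦⟧-∣₂ : ∀ a {c f} → (∀ x → c ∣₂ f x) → ∀ x → c ∣₂ ⟦ a ⟧ f x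
⟦⟧-∣₂ E       p x = p (1ℤ + x)
⟦⟧-∣₂ 𝟘       p x = ∣₂-0 _
⟦⟧-∣₂ 𝟙       p x = p x
⟦⟧-∣₂ (neg a) p x = ∣₂-neg (⟦⟧-∣₂ a p x)
⟦⟧-∣₂ (a ⊕ b) p x = ∣₂-+ (⟦⟧-∣₂ a p x) (⟦⟧-∣₂ b p x)
⟦⟧-∣₂ (a ⊛ b) p x = ⟦⟧-∣₂ a (⟦⟧-∣₂ b p) x

∇[_] : ℕ → Op
∇[ h ] = 𝟙 ⊕ neg (E ^ h)

-- Expand (2G + A)^m with A = 1 - E^h. The term i = 0 is the one subtracted; for i ≥ 1, 2^i supplies
-- 2 i!, and the hypothesis supplies (m - i)!, which survives the integral operator G^i.
∇^-frobenius : ∀ α g → (∀ i x → + (i !) ∣₂ ⟦ ∇[ 2 ℕ.^ α ] ^ i ⟧ g x) → ∀ m x →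
               + (2 ℕ.* m !) ∣₂ ⟦ ∇ ^ (2 ℕ.^ α ℕ.* m) ⟧ g x - ⟦ ∇[ 2 ℕ.^ α ] ^ m ⟧ g x
∇^-frobenius α g p m x = subst (+ (2 ℕ.* m !) ∣₂_) (sym eq)
  (∣₂-sum {n = m} (λ i → term (suc (toℕ i))) λ i → subst (+ (2 ℕ.* m !) ∣₂_) (sym (term≡ (suc (toℕ i))))
    (binomialTerm-∣₂ 2 {k = suc (toℕ i)} (Fin.toℕ<n i) (1^2∣! (suc (toℕ i)) z<s) (⟦⟧-∣₂ (G ^ suc (toℕ i)) (p (m ℕ.∸ suc (toℕ i))) x)))
  where
  h = 2 ℕ.^ α
  A = ∇[ h ]
  G = proj₁ (∇^2^ α)
  term : ℕ → ℤ
  term i = + (m C i) * ⟦ (G ⊕ G) ^ i ⟧ (⟦ A ^ (m ℕ.∸ i) ⟧ g) x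
  term≡ : ∀ i → term i ≡ + (m C i) * (+ (2 ℕ.^ i) * ⟦ G ^ i ⟧ (⟦ A ^ (m ℕ.∸ i) ⟧ g) x)
  term≡ i = cong (+ (m C i) *_) (double-^ G i (⟦ A ^ (m ℕ.∸ i) ⟧ g) x)
  S = Σℤ.sum {m} (λ i → term (suc (toℕ i)))
  lemma : ∀ a s → 1ℤ * a + s - a ≡ s
  lemma = solve-∀
  eq : ⟦ ∇ ^ (h ℕ.* m) ⟧ g x - ⟦ A ^ m ⟧ g x ≡ S
  eq = begin
    ⟦ ∇ ^ (h ℕ.* m) ⟧ g x - ⟦ A ^ m ⟧ g x   ≡⟨ cong (_- ⟦ A ^ m ⟧ g x) (^-assocʳ ∇ h m g x) ⟨
    ⟦ (∇ ^ h) ^ m ⟧ g x - ⟦ A ^ m ⟧ g x     ≡⟨ cong (_- ⟦ A ^ m ⟧ g x) (^-congˡ m {∇ ^ h} {G ⊕ G ⊕ A} (λ f y → trans (proj₂ (∇^2^ α) f y) (ℤ.+-comm (⟦ A ⟧ f y) _)) g x) ⟩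
    ⟦ (G ⊕ G ⊕ A) ^ m ⟧ g x - ⟦ A ^ m ⟧ g x ≡⟨ cong (_- ⟦ A ^ m ⟧ g x) (⟦binomial⟧ (G ⊕ G) A m g x) ⟩
    1ℤ * ⟦ A ^ m ⟧ g x + S - ⟦ A ^ m ⟧ g x  ≡⟨ lemma (⟦ A ^ m ⟧ g x) S ⟩
    S                                       ∎

-- Functions supported on the multiples of h

⟦E^⟧ : ∀ k f x → ⟦ E ^ k ⟧ f x ≡ f (+ k + x)
⟦E^⟧ zero    f x = cong f (sym (ℤ.+-identityˡ x))
⟦E^⟧ (suc k) f x = trans (⟦E^⟧ k f (1ℤ + x)) (cong f (lemma (+ k) x))
  where
  lemma : ∀ k x → k + (1ℤ + x) ≡ 1ℤ + k + x
  lemma = solve-∀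

Stretch : ℕ → (ℤ → ℤ) → (ℤ → ℤ) → Set
Stretch h q g = (∀ y → g (y * + h) ≡ q y) × (∀ x → ¬ + h ∣ x → g x ≡ 0ℤ)

-- A shift by h preserves both the multiples of h and their complement, and acts on the quotient by
-- h as a shift by 1.
∇-Stretch : ∀ h {q g} → Stretch h q g → Stretch h (⟦ ∇ ⟧ q) (⟦ ∇[ h ] ⟧ g)
∇-Stretch h {q} {g} (on , off) =
  (λ y → cong₂ _-_ (on y) (begin
    ⟦ E ^ h ⟧ g (y * + h)     ≡⟨ ⟦E^⟧ h g (y * + h) ⟩
    g (+ h + y * + h)         ≡⟨ cong g (ℤ.suc-* y (+ h)) ⟨
    g ((1ℤ + y) * + h)        ≡⟨ on (1ℤ + y) ⟩
    q (1ℤ + y)                ∎)) ,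
  (λ x h∤x → cong₂ _-_ (off x h∤x)
    (trans (⟦E^⟧ h g x) (off (+ h + x) λ h∣h+x → h∤x (∣m+n∣m⇒∣n h∣h+x ∣-refl))))

∇^-Stretch : ∀ h {q g} → Stretch h q g → ∀ m → Stretch h (⟦ ∇ ^ m ⟧ q) (⟦ ∇[ h ] ^ m ⟧ g)
∇^-Stretch h s zero    = s
∇^-Stretch h s (suc m) = ∇-Stretch h (∇^-Stretch h s m)

spread : ℤ → (ℤ → ℤ) → ℤ → ℤ
spread N F x with N ∣? x
... | yes (divides q _) = F q
... | no  _             = 0ℤ

spread-∣ : ∀ N .{{_ : ℤ.NonZero N}} F {x} q → x ≡ q * N → spread N F x ≡ F q
spread-∣ N F {x} q x≡qN with N ∣? x
... | yes (divides q′ x≡q′N) = cong F (ℤ.*-cancelʳ-≡ q′ q N (trans (sym x≡q′N) x≡qN))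
... | no  N∤x = contradiction (divides q x≡qN) N∤x

spread-∤ : ∀ N F {x} → ¬ N ∣ x → spread N F x ≡ 0ℤ
spread-∤ N F {x} N∤x with N ∣? x
... | yes N∣x = contradiction N∣x N∤x
... | no  _   = refl

-- The multiples of 2h are the products of h with even integers.
spread-Stretch : ∀ h .{{_ : ℕ.NonZero h}} F → Stretch h (spread (+ 2) F) (spread (+ (2 ℕ.* h)) F)
spread-Stretch h F = on , λ x h∤x → spread-∤ (+ (2 ℕ.* h)) F
    (λ { (divides q eq) → h∤x (divides (q * + 2) (trans eq (q*2h q))) })
  where
  q*2h : ∀ q → q * + (2 ℕ.* h) ≡ q * + 2 * + h
  q*2h q = trans (cong (q *_) (ℤ.pos-* 2 h)) (sym (ℤ.*-assoc q (+ 2) (+ h)))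
  on : ∀ y → spread (+ (2 ℕ.* h)) F (y * + h) ≡ spread (+ 2) F y
  on y with + 2 ∣? y
  ... | yes (divides q y≡q2) = spread-∣ (+ (2 ℕ.* h)) {{ℕ.m*n≢0 2 h}} F q (trans (cong (_* + h) y≡q2) (sym (q*2h q)))
  ... | no  2∤y = spread-∤ (+ (2 ℕ.* h)) F
    (λ { (divides q eq) → 2∤y (divides q (ℤ.*-cancelʳ-≡ y (q * + 2) (+ h) (trans eq (q*2h q)))) })

-1^2* : ∀ k → -1ℤ ℤ.^ (k ℕ.* 2) ≡ 1ℤ
-1^2* zero    = refl
-1^2* (suc k) = cong (λ z → -1ℤ * (-1ℤ * z)) (-1^2* k)

2∣⇒σ≡1 : ∀ {x} → + 2 ∣ x → σ x ≡ 1ℤ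
2∣⇒σ≡1 2∣x with ℕ.divides k eq ← ∣⇒∣ᵤ 2∣x = trans (cong (-1ℤ ℤ.^_) eq) (-1^2* k)

2∤⇒σ≡-1 : ∀ {x} → ¬ + 2 ∣ x → σ x ≡ -1ℤ
2∤⇒σ≡-1 {x} 2∤x with even-or-odd ℤ.∣ x ∣
... | k , inj₁ eq = contradiction (∣ᵤ⇒∣ (ℕ.divides k (trans eq (ℕ.*-comm 2 k)))) 2∤x
... | k , inj₂ eq = begin
  -1ℤ ℤ.^ ℤ.∣ x ∣         ≡⟨ cong (-1ℤ ℤ.^_) (trans eq (cong suc (ℕ.*-comm 2 k))) ⟩
  -1ℤ ℤ.^ suc (k ℕ.* 2)   ≡⟨ cong (-1ℤ *_) (-1^2* k) ⟩
  -1ℤ                     ∎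

2*spread : ∀ (f : ℤ → ℤ) y → + 2 * spread (+ 2) (λ q → f (q * + 2)) y ≡ f y + σ y * f y
2*spread f y with + 2 ∣? y
... | yes 2∣y@(divides q refl) = begin
  + 2 * f y          ≡⟨ ℤ.suc-* 1ℤ (f y) ⟩
  f y + 1ℤ * f y     ≡⟨ cong (λ s → f y + s * f y) (2∣⇒σ≡1 2∣y) ⟨
  f y + σ y * f y    ∎
... | no 2∤y = begin
  0ℤ                 ≡⟨ ℤ.+-inverseʳ (f y) ⟨
  f y - f y          ≡⟨ cong (ℤ._+_ (f y)) (ℤ.-1*i≡-i (f y)) ⟨
  f y + -1ℤ * f y    ≡⟨ cong (λ s → f y + s * f y) (2∤⇒σ≡-1 2∤y) ⟨
  f y + σ y * f y    ∎

-- The alternating sum as an iterated difference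

neg-E^ : ∀ k f x → ⟦ neg E ^ k ⟧ f x ≡ -1ℤ ℤ.^ k * f (+ k + x)
neg-E^ zero    f x = trans (cong f (sym (ℤ.+-identityˡ x))) (sym (ℤ.*-identityˡ _))
neg-E^ (suc k) f x = begin
  - ⟦ neg E ^ k ⟧ f (1ℤ + x)                  ≡⟨ cong -_ (neg-E^ k f (1ℤ + x)) ⟩
  - (-1ℤ ℤ.^ k * f (+ k + (1ℤ + x)))          ≡⟨ cong (λ z → - (-1ℤ ℤ.^ k * f z)) (lemma (+ k) x) ⟩
  - (-1ℤ ℤ.^ k * f (1ℤ + + k + x))            ≡⟨ lemma′ (-1ℤ ℤ.^ k) _ ⟩
  -1ℤ * -1ℤ ℤ.^ k * f (1ℤ + + k + x)          ∎
  where
  lemma : ∀ k x → k + (1ℤ + x) ≡ 1ℤ + k + x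
  lemma = solve-∀
  lemma′ : ∀ s y → - (s * y) ≡ -1ℤ * s * y
  lemma′ = solve-∀

∇^-sum : ∀ n f x → ⟦ ∇ ^ n ⟧ f x ≡ Σℤ.sum {suc n} (λ k → + (n C toℕ k) * -1ℤ ℤ.^ toℕ k * f (+ toℕ k + x))
∇^-sum n f x = begin
  ⟦ ∇ ^ n ⟧ f x               ≡⟨ ^-congˡ n {∇} {neg E ⊕ 𝟙} (λ g y → ℤ.+-comm (g y) _) f x ⟩
  ⟦ (neg E ⊕ 𝟙) ^ n ⟧ f x     ≡⟨ ⟦binomial⟧ (neg E) 𝟙 n f x ⟩
  _                           ≡⟨ Σℤ.sum-cong-≗ {suc n} (λ k → trans (cong (+ (n C toℕ k) *_)
                                   (trans (⟦⟧-cong (neg E ^ toℕ k) (𝟙^ (n ℕ.∸ toℕ k) f) x) (neg-E^ (toℕ k) f x)))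
                                   (sym (ℤ.*-assoc (+ (n C toℕ k)) (-1ℤ ℤ.^ toℕ k) (f (+ toℕ k + x))))) ⟩
  _                           ∎

-- At x = k - r this is l! 2^l times the generalised binomial coefficient in `T`, extended by 0 to
-- the excluded k.
summand : ℕ → ℕ → ℤ → ℤ
summand l β = spread (+ (2 ℕ.^ β)) (λ q → falling₂ l (q * + 2))

δℤ : ℕ → ℕ → ℤ → ℤ
δℤ l d z with l ℕ.≟ d
... | yes _ = z
... | no _  = 0ℤ

-- The intermediate value `⟦ ∇[ h ] ^ m ⟧ g x` links the two congruences: `∇^-frobenius` reaches it,
-- and stretching identifies it with the difference of `q` at -c.
∇^-summand : ∀ α c d e → d ℕ.< 2 ℕ.^ e → ∀ l → l ℕ.≤ d → let m = 2 ℕ.^ e ℕ.+ d in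
  + (2 ℕ.* m !) ∣₂ ⟦ ∇ ^ (2 ℕ.^ α ℕ.* m) ⟧ (summand l (suc α)) (- + (2 ℕ.^ α ℕ.* c)) - δℤ l d (+ (m !))
∇^-summand α c d e d<2^e l l≤d = subst (+ (2 ℕ.* m !) ∣₂_) (lemma (⟦ ∇ ^ (h ℕ.* m) ⟧ g x) (⟦ ∇[ h ] ^ m ⟧ g x) (δℤ l d (+ (m !))))
  (∣₂-+ (∇^-frobenius α g i!∣₂ m x) (subst (λ z → + (2 ℕ.* m !) ∣₂ z - δℤ l d (+ (m !))) (sym at-x) base))
  where
  h = 2 ℕ.^ α
  m = 2 ℕ.^ e ℕ.+ d
  x = - + (h ℕ.* c)
  f = falling₂ l
  q = spread (+ 2) (λ y → f (y * + 2))
  g = summand l (suc α)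
  instance
    h≢0 : ℕ.NonZero h
    h≢0 = ℕ.m^n≢0 2 α
  stretch : ∀ i → Stretch h (⟦ ∇ ^ i ⟧ q) (⟦ ∇[ h ] ^ i ⟧ g)
  stretch = ∇^-Stretch h (spread-Stretch h (λ y → f (y * + 2)))
  i!∣₂ : ∀ i y → + (i !) ∣₂ ⟦ ∇[ h ] ^ i ⟧ g y
  i!∣₂ i y with + h ∣? y
  ... | yes (divides k refl) = subst (+ (i !) ∣₂_) (sym (proj₁ (stretch i) k)) (m!∣₂∇^m l q (2*spread f) i k)
  ... | no h∤y = subst (+ (i !) ∣₂_) (sym (proj₂ (stretch i) y h∤y)) (∣₂-0 _)
  at-x : ⟦ ∇[ h ] ^ m ⟧ g x ≡ ⟦ ∇ ^ m ⟧ q (- + c)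
  -- The point -(hc) has to be rewritten as (-c)h, the form in which `Stretch` evaluates at
  -- multiples.
  at-x = trans (cong (⟦ ∇[ h ] ^ m ⟧ g) (trans (cong (λ z → - + z) (ℕ.*-comm h c)) (trans (cong -_ (ℤ.pos-* c h)) (ℤ.neg-distribˡ-* (+ c) (+ h)))))
    (proj₁ (stretch m) (- + c))
  base : + (2 ℕ.* m !) ∣₂ ⟦ ∇ ^ m ⟧ q (- + c) - δℤ l d (+ (m !))
  base with l ℕ.≟ d
  ... | yes l≡d = 2m!∣₂∇^m-m! l q (2*spread f) e d d<2^e l≤d (- + c) l≡d
  ... | no l≢d = 2m!∣₂∇^m l q (2*spread f) e d d<2^e l≤d (- + c) l≢d
  lemma : ∀ a b c → (a - b) + (b - c) ≡ a - c
  lemma = solve-∀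

-- Rational numbers

ord₂ℕ-odd : ∀ m → ¬ 2 ℕ.∣ m → ord₂ℕ m ≡ 0
ord₂ℕ-odd m 2∤m = ℕ.n≤0⇒n≡0 (max≤v⁺ z≤n (All.map a≤0 (all-filter (λ a → 2 ℕ.^ a ℕ.∣? m) (upTo m))))
  where
  a≤0 : ∀ {a} → 2 ℕ.^ a ℕ.∣ m → a ℕ.≤ 0
  a≤0 {zero}  _ = z≤n
  a≤0 {suc a} p = contradiction (ℕ.∣-trans (ℕ.m∣m*n (2 ℕ.^ a)) p) 2∤m

1≤ord₂ℕ : ∀ m .{{_ : ℕ.NonZero m}} → 2 ℕ.∣ m → 1 ℕ.≤ ord₂ℕ m
1≤ord₂ℕ m 2∣m = v≤max⁺ 0 (filter (λ a → 2 ℕ.^ a ℕ.∣? m) (upTo m))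
  -- The exponent 1 is in the list: 2 divides the nonzero m, so 1 < m.
  (inj₂ (lose (∈-filter⁺ (λ a → 2 ℕ.^ a ℕ.∣? m) (∈-upTo⁺ (ℕ.∣⇒≤ 2∣m)) 2∣m) ℕ.≤-refl))

odd-*-even : ∀ {o x} → Odd o → + 2 ∣ o * x → + 2 ∣ x
odd-*-even {x = x} (k , refl) (divides q eq) = divides (q - k * x) (begin
  x                                          ≡⟨ lemma k x ⟩
  (1ℤ + + 2 * k) * x - k * x * + 2           ≡⟨ cong (_- k * x * + 2) eq ⟩
  q * + 2 - k * x * + 2                      ≡⟨ lemma′ q (k * x) ⟩
  (q - k * x) * + 2                          ∎)
  where
  lemma : ∀ k x → x ≡ (1ℤ + + 2 * k) * x - k * x * + 2
  lemma = solve-∀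
  lemma′ : ∀ q y → q * + 2 - y * + 2 ≡ (q - y) * + 2
  lemma′ = solve-∀

toℚᵘ-/ : ∀ i n .{{_ : ℕ.NonZero n}} → toℚᵘ (i / n) ≃ (i ℚᵘ./ n)
toℚᵘ-/ i (suc n) = ℚ.toℚᵘ-fromℚᵘ (mkℚᵘ i n)

/-*-/ : ∀ i j m n .{{_ : ℕ.NonZero m}} .{{_ : ℕ.NonZero n}} → (i / m) ℚ.* (j / n) ≡ ((i * j) / (m ℕ.* n)) {{ℕ.m*n≢0 m n}}
/-*-/ i j m@(suc _) n@(suc _) = ℚ.toℚᵘ-injective (ℚᵘ.≃-trans (ℚ.toℚᵘ-homo-* (i / m) (j / n))
  (ℚᵘ.≃-trans (ℚᵘ.*-cong (toℚᵘ-/ i m) (toℚᵘ-/ j n)) (ℚᵘ.≃-sym (toℚᵘ-/ (i * j) (m ℕ.* n)))))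

/≡/ : ∀ i j m n .{{_ : ℕ.NonZero m}} .{{_ : ℕ.NonZero n}} → i * + n ≡ j * + m → i / m ≡ j / n
/≡/ i j m@(suc _) n@(suc _) eq = ℚ.fromℚᵘ-cong {mkℚᵘ i _} {mkℚᵘ j _} (*≡* eq)

/1-* : ∀ i j → (i / 1) ℚ.* (j / 1) ≡ (i * j) / 1
/1-* i j = /-*-/ i j 1 1

/1-+ : ∀ i j → (i / 1) ℚ.+ (j / 1) ≡ (i + j) / 1
/1-+ i j = ℚ.toℚᵘ-injective (ℚᵘ.≃-trans (ℚ.toℚᵘ-homo-+ (i / 1) (j / 1))
  (ℚᵘ.≃-trans (ℚᵘ.+-cong (toℚᵘ-/ i 1) (toℚᵘ-/ j 1)) (ℚᵘ.≃-trans (*≡* (lemma i j)) (ℚᵘ.≃-sym (toℚᵘ-/ (i + j) 1)))))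
  where
  lemma : ∀ i j → (i * 1ℤ + j * 1ℤ) * 1ℤ ≡ (i + j) * 1ℤ
  lemma = solve-∀

/1-neg : ∀ i → ℚ.- (i / 1) ≡ (- i) / 1
/1-neg i = ℚ.toℚᵘ-injective (ℚᵘ.≃-trans (ℚ.toℚᵘ-homo‿- (i / 1))
  (ℚᵘ.≃-trans (ℚᵘ.-‿cong (toℚᵘ-/ i 1)) (ℚᵘ.≃-sym (toℚᵘ-/ (- i) 1))))

/1-- : ∀ i j → (i / 1) ℚ.- (j / 1) ≡ (i - j) / 1
/1-- i j = trans (cong ((i / 1) ℚ.+_) (/1-neg j)) (/1-+ i (- j))

/-*-cancel : ∀ i n .{{_ : ℕ.NonZero n}} → (i / n) ℚ.* (+ n / 1) ≡ i / 1
/-*-cancel i n@(suc _) = trans (/-*-/ i (+ n) n 1) (/≡/ (i * + n) i (n ℕ.* 1) 1 (trans (ℤ.*-identityʳ _) (cong (λ k → i * + k) (sym (ℕ.*-identityʳ n)))))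

*/≡/1 : ∀ q n .{{_ : ℕ.NonZero n}} → (q * + n) / n ≡ q / 1
*/≡/1 q n = /≡/ (q * + n) q n 1 (ℤ.*-identityʳ _)

-- Write a nonzero u as p/d in lowest terms. Cancelling b makes an odd multiple of p equal to 2wd,
-- so p is even; then d is odd by coprimality, and ord₂ u is that of p. For u = 0 the order is
-- infinite.
∣₂⇒≡0[mod2] : ∀ u b z .{{_ : ℕ.NonZero b}} → u ℚ.* (+ b / 1) ≡ z / 1 → + (2 ℕ.* b) ∣₂ z → [ 1ℤ ] ≤⁺ ord₂ u
∣₂⇒≡0[mod2] u b z ub≡z 2b∣z with u ℚ.≟ 0ℚ
... | yes _ = _ ≤⊤⁺
∣₂⇒≡0[mod2] u@(mkℚ p d-1 coprime) b z ub≡z (o , oddo , divides w oz≡w2b) | no u≢0 =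
  [ subst (λ k → 1ℤ ℤ.≤ + ord₂ℕ ℤ.∣ p ∣ - + k) (sym (ord₂ℕ-odd d 2∤d))
      (subst (1ℤ ℤ.≤_) (sym (ℤ.+-identityʳ _)) (ℤ.+≤+ (1≤ord₂ℕ ℤ.∣ p ∣ {{p≢0}} 2∣∣p∣))) ]
  where
  d = suc d-1
  pb≡zd : p * + b ≡ z * + d
  pb≡zd with *≡* eq ← ℚᵘ.≃-trans (ℚᵘ.≃-sym (ℚᵘ.≃-trans (ℚ.toℚᵘ-homo-* u (+ b / 1)) (ℚᵘ.*-congˡ {toℚᵘ u} (toℚᵘ-/ (+ b) 1))))
                          (ℚᵘ.≃-trans (ℚ.toℚᵘ-cong ub≡z) (toℚᵘ-/ z 1)) =
    trans (sym (ℤ.*-identityʳ _)) (trans eq (cong (λ k → z * + k) (ℕ.*-identityʳ d)))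
  op≡ : o * p ≡ w * + d * + 2
  op≡ = ℤ.*-cancelʳ-≡ (o * p) (w * + d * + 2) (+ b) (begin
    o * p * + b               ≡⟨ ℤ.*-assoc o p (+ b) ⟩
    o * (p * + b)             ≡⟨ cong (o *_) pb≡zd ⟩
    o * (z * + d)             ≡⟨ ℤ.*-assoc o z (+ d) ⟨
    o * z * + d               ≡⟨ cong (_* + d) oz≡w2b ⟩
    w * + (2 ℕ.* b) * + d     ≡⟨ cong (λ k → w * k * + d) (ℤ.pos-* 2 b) ⟩
    w * (+ 2 * + b) * + d     ≡⟨ lemma w (+ b) (+ d) ⟩
    w * + d * + 2 * + b       ∎)
    where
    lemma : ∀ w b d → w * (+ 2 * b) * d ≡ w * d * + 2 * b
    lemma = solve-∀
  2∣∣p∣ : 2 ℕ.∣ ℤ.∣ p ∣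
  2∣∣p∣ = ∣⇒∣ᵤ (odd-*-even oddo (divides (w * + d) op≡))
  p≢0 : ℕ.NonZero ℤ.∣ p ∣
  p≢0 = ℕ.≢-nonZero λ ∣p∣≡0 → u≢0 (ℚ.↥p≡0⇒p≡0 u (ℤ.∣i∣≡0⇒i≡0 ∣p∣≡0))
  2∤d : ¬ 2 ℕ.∣ d
  -- The coprimality field is irrelevant and must be recomputed before use; it would give 2 ≡ 1.
  2∤d 2∣d with () ← recompute coprime (2∣∣p∣ , 2∣d)

-- `upTo` is `applyUpTo` of the identity; a general `φ` is needed because the induction precomposes
-- it with `suc`.
*-sumℚ-filter : ∀ {P : ℕ → Set} (P? : Decidable P) (t : ℕ → ℚ) (z : ℕ → ℤ) L →
  (∀ k → P k → L ℚ.* t k ≡ z k / 1) → (∀ k → ¬ P k → z k ≡ 0ℤ) → ∀ φ n →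
  L ℚ.* sumℚ (map t (filter P? (applyUpTo φ n))) ≡ Σℤ.sum {n} (λ i → z (φ (toℕ i))) / 1
*-sumℚ-filter P? t z L on off φ zero = ℚ.*-zeroʳ L
*-sumℚ-filter P? t z L on off φ (suc n) with P? (φ 0)
... | yes p = begin
  L ℚ.* (t (φ 0) ℚ.+ s)              ≡⟨ ℚ.*-distribˡ-+ L (t (φ 0)) s ⟩
  L ℚ.* t (φ 0) ℚ.+ L ℚ.* s          ≡⟨ cong₂ ℚ._+_ (on (φ 0) p) (*-sumℚ-filter P? t z L on off (λ i → φ (suc i)) n) ⟩
  z (φ 0) / 1 ℚ.+ Σℤ.sum {n} (λ i → z (φ (suc (toℕ i)))) / 1   ≡⟨ /1-+ (z (φ 0)) _ ⟩
  _                                  ∎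
  where s = sumℚ (map t (filter P? (applyUpTo (λ i → φ (suc i)) n)))
... | no ¬p = trans (*-sumℚ-filter P? t z L on off (λ i → φ (suc i)) n)
  (cong (_/ 1) (sym (trans (cong (_+ Z) (off (φ 0) ¬p)) (ℤ.+-identityˡ Z))))
  where Z = Σℤ.sum {n} (λ i → z (φ (suc (toℕ i))))

-- Each of the l factors q - i absorbs one factor 2.
falling-falling₂ : ∀ l q → falling (q / 1) l ℚ.* (+ (2 ℕ.^ l) / 1) ≡ falling₂ l (q * + 2) / 1
falling-falling₂ zero    q = refl
falling-falling₂ (suc l) q = begin
  F ℚ.* ((q / 1) ℚ.- (+ l / 1)) ℚ.* (+ (2 ℕ.^ suc l) / 1)    ≡⟨ cong₂ (λ x y → F ℚ.* x ℚ.* y) (/1-- q (+ l)) (trans (cong (_/ 1) (trans (cong +_ (ℕ.*-comm 2 (2 ℕ.^ l))) (ℤ.pos-* (2 ℕ.^ l) 2))) (sym (/1-* (+ (2 ℕ.^ l)) (+ 2)))) ⟩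
  F ℚ.* G ℚ.* (P ℚ.* (+ 2 / 1))                                ≡⟨ ℚ*.interchange F G P (+ 2 / 1) ⟩
  F ℚ.* P ℚ.* (G ℚ.* (+ 2 / 1))                                ≡⟨ cong₂ ℚ._*_ (falling-falling₂ l q) (/1-* (q - + l) (+ 2)) ⟩
  (f / 1) ℚ.* (((q - + l) * + 2) / 1)                          ≡⟨ /1-* f ((q - + l) * + 2) ⟩
  (f * ((q - + l) * + 2)) / 1                                  ≡⟨ cong (λ x → (f * x) / 1) (trans (lemma q (+ l)) (cong (ℤ._-_ (q * + 2)) (sym (ℤ.pos-* 2 l)))) ⟩
  (f * (q * + 2 - + (2 ℕ.* l))) / 1                            ∎
  where
  F = falling (q / 1) l
  G = (q - + l) / 1
  P = + (2 ℕ.^ l) / 1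
  f = falling₂ l (q * + 2)
  lemma : ∀ q l → (q - l) * + 2 ≡ q * + 2 - + 2 * l
  lemma = solve-∀

*-binom : ∀ l q → (+ (l ! ℕ.* 2 ℕ.^ l) / 1) ℚ.* binom (q / 1) l ≡ falling₂ l (q * + 2) / 1
*-binom l q = begin
  (+ (l ! ℕ.* 2 ℕ.^ l) / 1) ℚ.* (F ℚ.* I)    ≡⟨ cong (ℚ._* (F ℚ.* I)) (trans (cong (_/ 1) (ℤ.pos-* (l !) (2 ℕ.^ l))) (sym (/1-* (+ (l !)) (+ (2 ℕ.^ l))))) ⟩
  K ℚ.* P ℚ.* (F ℚ.* I)                      ≡⟨ cong₂ ℚ._*_ (ℚ.*-comm K P) (ℚ.*-comm F I) ⟩
  P ℚ.* K ℚ.* (I ℚ.* F)                      ≡⟨ ℚ.*-comm (P ℚ.* K) (I ℚ.* F) ⟩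
  I ℚ.* F ℚ.* (P ℚ.* K)                      ≡⟨ cong (I ℚ.* F ℚ.*_) (ℚ.*-comm P K) ⟩
  I ℚ.* F ℚ.* (K ℚ.* P)                      ≡⟨ ℚ*.interchange I F K P ⟩
  I ℚ.* K ℚ.* (F ℚ.* P)                      ≡⟨ cong₂ ℚ._*_ (/-*-cancel 1ℤ (l !) {{l ℕ.!≢0}}) (falling-falling₂ l q) ⟩
  1ℚ ℚ.* (falling₂ l (q * + 2) / 1)          ≡⟨ ℚ.*-identityˡ _ ⟩
  falling₂ l (q * + 2) / 1                   ∎
  where
  F = falling (q / 1) l
  K = + (l !) / 1
  P = + (2 ℕ.^ l) / 1
  I = (1ℤ / (l !)) {{l ℕ.!≢0}}

-- Multiplication by N! clears the denominator of the prefactor, and l! 2^l makes every summand an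
-- integer. The floor is named by a variable `N`, so that any number equal to it can be used.
T-*-! : ∀ l β n r N → ((2 ℕ.* n) ℕ./ 2 ℕ.^ β) {{ℕ.m^n≢0 2 β}} ≡ N →
        T l β n r ℚ.* (+ (N !) / 1) ≡ ⟦ ∇ ^ n ⟧ (summand l β) (- r) / 1
T-*-! l β n r N refl = begin
  (+ (l ! ℕ.* 2 ℕ.^ l) / (N !)) ℚ.* S ℚ.* (+ (N !) / 1)    ≡⟨ ℚ*.xy∙z≈xz∙y (+ (l ! ℕ.* 2 ℕ.^ l) / (N !)) S (+ (N !) / 1) ⟩
  (+ (l ! ℕ.* 2 ℕ.^ l) / (N !)) ℚ.* (+ (N !) / 1) ℚ.* S    ≡⟨ cong (ℚ._* S) (/-*-cancel (+ (l ! ℕ.* 2 ℕ.^ l)) (N !)) ⟩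
  L ℚ.* S                                                    ≡⟨ *-sumℚ-filter P? t z L on off (λ k → k) (suc n) ⟩
  Σℤ.sum {suc n} (λ k → z (toℕ k)) / 1                       ≡⟨ cong (_/ 1) (∇^-sum n (summand l β) (- r)) ⟨
  ⟦ ∇ ^ n ⟧ (summand l β) (- r) / 1                          ∎
  where
  instance
    _ = ℕ.m^n≢0 2 β
    _ = N ℕ.!≢0
  L = + (l ! ℕ.* 2 ℕ.^ l) / 1
  P? = λ k → + (2 ℕ.^ β) ∣? (+ k - r)
  t : ℕ → ℚ
  t k = ((+ (n C k) * -1ℤ ℤ.^ k) / 1) ℚ.* binom ((+ k - r) / 2 ℕ.^ β) l
  z : ℕ → ℤ
  z k = + (n C k) * -1ℤ ℤ.^ k * summand l β (+ k - r)
  S = sumℚ (map t (filter P? (upTo (suc n))))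
  off : ∀ k → ¬ + (2 ℕ.^ β) ∣ (+ k - r) → z k ≡ 0ℤ
  off k ∤ = trans (cong (+ (n C k) * -1ℤ ℤ.^ k *_) (spread-∤ (+ (2 ℕ.^ β)) _ ∤)) (ℤ.*-zeroʳ (+ (n C k) * -1ℤ ℤ.^ k))
  on : ∀ k → + (2 ℕ.^ β) ∣ (+ k - r) → L ℚ.* t k ≡ z k / 1
  on k (divides q eq) = begin
    L ℚ.* (B ℚ.* binom ((+ k - r) / 2 ℕ.^ β) l)    ≡⟨ cong (λ x → L ℚ.* (B ℚ.* binom x l)) (trans (cong (_/ 2 ℕ.^ β) eq) (*/≡/1 q (2 ℕ.^ β))) ⟩
    L ℚ.* (B ℚ.* binom (q / 1) l)                  ≡⟨ ℚ*.x∙yz≈y∙xz L B (binom (q / 1) l) ⟩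
    B ℚ.* (L ℚ.* binom (q / 1) l)                  ≡⟨ cong (B ℚ.*_) (*-binom l q) ⟩
    B ℚ.* (falling₂ l (q * + 2) / 1)               ≡⟨ /1-* (+ (n C k) * -1ℤ ℤ.^ k) (falling₂ l (q * + 2)) ⟩
    (+ (n C k) * -1ℤ ℤ.^ k * falling₂ l (q * + 2)) / 1  ≡⟨ cong (λ x → (+ (n C k) * -1ℤ ℤ.^ k * x) / 1) (spread-∣ (+ (2 ℕ.^ β)) _ q eq) ⟨
    z k / 1                                        ∎
    where
    B = (+ (n C k) * -1ℤ ℤ.^ k) / 1

δ-* : ∀ l d b → δ l d ℚ.* (+ b / 1) ≡ δℤ l d (+ b) / 1
δ-* l d b with l ℕ.≟ d
... | yes l≡d = trans (cong (λ t → (if t then 1ℚ else 0ℚ) ℚ.* (+ b / 1)) (dec-true (l ℕ.≟ d) l≡d)) (ℚ.*-identityˡ (+ b / 1))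
... | no  l≢d = trans (cong (λ t → (if t then 1ℚ else 0ℚ) ℚ.* (+ b / 1)) (dec-false (l ℕ.≟ d) l≢d)) (ℚ.*-zeroˡ (+ b / 1))

theorem4p1 : (α c d e : ℕ) → d ℕ.< 2 ℕ.^ e →
    (l : ℕ) → l ℕ.≤ d →
    T l (suc α) (2 ℕ.^ α ℕ.* (2 ℕ.^ e ℕ.+ d)) (+ (2 ℕ.^ α ℕ.* c)) ≡ δ l d [mod2]
theorem4p1 α c d e d<2^e l l≤d = ∣₂⇒≡0[mod2] (t ℚ.- δ l d) (m !) (W - δℤ l d (+ (m !))) {{m ℕ.!≢0}} (begin
    (t ℚ.- δ l d) ℚ.* M            ≡⟨ ℚ.*-distribʳ-+ M t (ℚ.- δ l d) ⟩
    t ℚ.* M ℚ.+ (ℚ.- δ l d) ℚ.* M  ≡⟨ cong (t ℚ.* M ℚ.+_) (ℚ.neg-distribˡ-* (δ l d) M) ⟨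
    t ℚ.* M ℚ.- δ l d ℚ.* M        ≡⟨ cong₂ ℚ._-_ (T-*-! l (suc α) (h ℕ.* m) (+ (h ℕ.* c)) m floor≡m) (δ-* l d (m !)) ⟩
    W / 1 ℚ.- δℤ l d (+ (m !)) / 1 ≡⟨ /1-- W (δℤ l d (+ (m !))) ⟩
    (W - δℤ l d (+ (m !))) / 1     ∎)
  (∇^-summand α c d e d<2^e l l≤d)
  where
  h = 2 ℕ.^ α
  m = 2 ℕ.^ e ℕ.+ d
  t = T l (suc α) (h ℕ.* m) (+ (h ℕ.* c))
  M = + (m !) / 1
  W = ⟦ ∇ ^ (h ℕ.* m) ⟧ (summand l (suc α)) (- + (h ℕ.* c))
  instance
    2h≢0 : ℕ.NonZero (2 ℕ.* h)
    2h≢0 = ℕ.m^n≢0 2 (suc α)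
  floor≡m : (2 ℕ.* (h ℕ.* m)) ℕ./ (2 ℕ.* h) ≡ m
  -- `2 ^ suc α` unfolds to `2 * h`, so the doubled numerator in `T` is an exact multiple of the
  -- divisor.
  floor≡m = trans (ℕ./-congˡ (trans (sym (ℕ.*-assoc 2 h m)) (ℕ.*-comm (2 ℕ.* h) m))) (ℕ.m*n/n≡m m (2 ℕ.* h))
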